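{- Let $\mathrm{st}:\mathfrak{S}\to\mathbb{N}$ be a permutation statistic with $\mathrm{st}(\epsilon)=0$ for which there is a function $f:\mathbb{N}^2\to\mathbb{N}$ such that for all integers $0\le k\le n$ and all $\sigma_1\in\mathfrak{S}_k(312)$, $\sigma_2\in\mathfrak{S}_{n-k}(312)$, the permutation $\sigma=213[\sigma_1,1,\sigma_2]$ satisfies $$\mathrm{st}(\sigma)=f(k,n-k)+\mathrm{st}(\sigma_1)+\mathrm{st}(\sigma_2).$$ Let $m\ge 1$, let $\pi^{(1)},\dots,\pi^{(m)}$ be $312$-avoiding permutations with block decompositions $\pi^{(j)}=\iota_{r_j}[(\pi^{(j)}_1)_*,\dots,(\pi^{(j)}_{r_j})_*]$, and let $\Pi=\{312,\pi^{(1)},\dots,\pi^{(m)}\}$. Then $F^{\mathrm{st}}_0(\Pi;q)=0$ if some $\pi^{(j)}=\epsilon$ and $F^{\mathrm{st}}_0(\Pi;q)=1$ otherwise, and for $n\ge 1$ $$F^{\mathrm{st}}_{n+1}(\Pi;q)=\sum_{k=0}^n q^{f(k,n-k)}\Bigg[\sum_{S\subseteq\{1,\dots,m\}}(-1)^{|S|}\sum_{\substack{I=(i_1,\dots,i_m):\\ 1\le i_j\le r_j-\delta_j}}F^{\mathrm{st}}_k(\underline{\Pi}_I;q)\,F^{\mathrm{st}}_{n-k}(\overline{\Pi}_{I+\delta};q)\Bigg],$$ where, for each $S$, $\delta=(\delta_1,\dots,\delta_m)$ with $\delta_j=1$ if $j\in S$ and $\delta_j=0$ if $j\notin S$.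
   Context: $\mathbb{N}$ is the set of nonnegative integers. $\mathfrak{S}_n$ is the set of permutations of $\{1,\dots,n\}$ in one-line notation, $\mathfrak{S}=\bigcup_{n\ge 0}\mathfrak{S}_n$, and $\mathfrak{S}_0=\{\epsilon\}$ with $\epsilon$ the empty permutation. A permutation $\sigma$ contains $\pi$ if some subsequence of $\sigma$ has the same relative order as $\pi$ (so every permutation contains $\epsilon$); otherwise $\sigma$ avoids $\pi$. For $\Pi\subseteq\mathfrak{S}$, $\mathfrak{S}_n(\Pi)$ is the set of $\sigma\in\mathfrak{S}_n$ avoiding every pattern in $\Pi$; $\mathfrak{S}_n(312)=\mathfrak{S}_n(\{312\})$. For a statistic $\mathrm{st}:\mathfrak{S}\to\mathbb{N}$, $F^{\mathrm{st}}_n(\Pi;q)=\sum_{\sigma\in\mathfrak{S}_n(\Pi)}q^{\mathrm{st}(\sigma)}$. For $\tau\in\mathfrak{S}_k$ and $\sigma_1,\dots,\sigma_k\in\mathfrak{S}$, the inflation $\tau[\sigma_1,\dots,\sigma_k]$ is the permutation that is a concatenation of $k$ consecutive blocks of positions, the $i$-th block (of length $|\sigma_i|$) having the relative order of $\sigma_i$ and occupying an interval of values, with the blocks' value intervals arranged relative to one another in the order of $\tau$; e.g. $213[123,1,21]=234165$. $\iota_r=12\cdots r$ is the identity of $\mathfrak{S}_r$ (and $\iota_0[\,]=\epsilon$). For $\pi\in\mathfrak{S}_m$, $\pi_*:=21[\pi,1]$, i.e. $\pi_*=(\pi(1)+1)\cdots(\pi(m)+1)\,1$; and $\pi_{i*}=(\pi_i)_*$.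 Every $312$-avoiding permutation $\pi$ can be written uniquely as $\pi=\iota_r[\pi_{1*},\dots,\pi_{r*}]$ with $r\ge 0$ and each $\pi_i$ a $312$-avoiding permutation; this is its block decomposition. For $1\le i\le r$ define $\underline{\pi}(1)=\pi_1$, $\underline{\pi}(i)=\iota_i[\pi_{1*},\dots,\pi_{i*}]$ for $i\ge 2$, and $\overline{\pi}(i)=\iota_{r-i+1}[\pi_{i*},\dots,\pi_{r*}]$ for $1\le i\le r$. For $\Pi=\{312,\pi^{(1)},\dots,\pi^{(m)}\}$ with block decompositions as in the claim and $I=(i_1,\dots,i_m)$ with $1\le i_j\le r_j$, define $$\underline{\Pi}_I=\{312,\underline{\pi^{(1)}}(i_1),\dots,\underline{\pi^{(m)}}(i_m)\},\qquad \overline{\Pi}_I=\{312,\overline{\pi^{(1)}}(i_1),\dots,\overline{\pi^{(m)}}(i_m)\}.$$ -}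

module Defs where

open import Data.Fin using (Fin)
open import Data.Fin.Subset using (Subset; inside; outside)
open import Data.Integer as ℤ using (ℤ; 0ℤ; 1ℤ)
open import Data.List using
  (List; []; _∷_; length; map; concat; foldr; take; drop; zip; tabulate; filter;
   applyUpTo; cartesianProductWith; mapMaybe)
open import Data.List.Properties using
  (length-applyUpTo; length-map; length-++)
open import Data.List.Membership.Propositional using (_∈_)
open import Data.List.Relation.Unary.Any using (here; there)
open import Data.List.Membership.Propositional.Properties using (∈-map⁻)
open import Data.List.Relation.Unary.All as All using (All; []; _∷_)
import Data.List.Relation.Unary.All.Properties as All
open import Data.List.Relation.Unary.AllPairs using (AllPairs; []; _∷_)
open import Data.List.Relation.Unary.Unique.Propositional using (Unique)
import Data.List.Relation.Unary.Unique.Propositional.Properties as Unique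
open import Data.List.Relation.Binary.Disjoint.Propositional using (Disjoint)
open import Data.List.Relation.Binary.Sublist.Propositional using (_⊆_; []; _∷ʳ_; _∷_)
open import Data.Maybe as Maybe using ()
open import Data.Nat using (ℕ; zero; suc; _+_; _∸_; _≤_; _<_; z≤n; s≤s)
open import Data.Nat.Properties
open import Data.Product using (∃; _×_; _,_; proj₁; proj₂)
open import Data.Sum using (inj₁; inj₂; [_,_]′)
open import Data.Vec as Vec using (Vec; []; _∷_)
open import Function using (_∘_)
open import Relation.Binary.Definitions using (tri<; tri≈; tri>)
open import Relation.Binary.PropositionalEquality
open import Relation.Nullary using (¬_; Dec; yes; no; ¬?; contradiction)
open import Relation.Nullary.Decidable using
  (True; toWitness; dec⇒maybe; recompute; map′; _×-dec_; _→-dec_; _⊎-dec_)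

open import Data.List.Relation.Unary.Unique.DecPropositional _≟_ using (unique?)

------------------------------------------------------------------------
-- Polynomials over ℤ in one indeterminate q: the list c₀ ∷ c₁ ∷ … stands
-- for c₀ + c₁ q + ….  Trailing zeros are allowed, so equality of
-- polynomials is equality of all coefficients.

ℤ[q] : Set
ℤ[q] = List ℤ

coeff : ℤ[q] → ℕ → ℤ
coeff []      _       = 0ℤ
coeff (c ∷ p) zero    = c
coeff (c ∷ p) (suc d) = coeff p d

infix 4 _≈_
_≈_ : ℤ[q] → ℤ[q] → Set
p ≈ r = ∀ d → coeff p d ≡ coeff r d

infixl 6 _⊞_
_⊞_ : ℤ[q] → ℤ[q] → ℤ[q]
[]      ⊞ r       = r
(c ∷ p) ⊞ []      = c ∷ p
(c ∷ p) ⊞ (e ∷ r) = (c ℤ.+ e) ∷ (p ⊞ r)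

infixr 8 _·_
_·_ : ℤ → ℤ[q] → ℤ[q]
c · p = map (c ℤ.*_) p

infixl 7 _⊠_
_⊠_ : ℤ[q] → ℤ[q] → ℤ[q]
[]      ⊠ r = []
(c ∷ p) ⊠ r = c · r ⊞ (0ℤ ∷ (p ⊠ r))

𝟘 𝟙 : ℤ[q]
𝟘 = []
𝟙 = 1ℤ ∷ []

q^_ : ℕ → ℤ[q]
q^ zero  = 𝟙
q^ suc e = 0ℤ ∷ (q^ e)

infix 5 ∑
∑ : {A : Set} → List A → (A → ℤ[q]) → ℤ[q]
∑ xs t = foldr (λ x s → t x ⊞ s) 𝟘 xs

syntax ∑ xs (λ x → t) = ∑[ x ∈ xs ] t

------------------------------------------------------------------------
-- Permutations in one-line notation.  The validity proof is irrelevant, so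
-- permutations with the same word are equal.

IsPermutation : List ℕ → Set
IsPermutation w = Unique w × All (λ x → 1 ≤ x × x ≤ length w) w

isPermutation? : ∀ w → Dec (IsPermutation w)
isPermutation? w = unique? w ×-dec All.all? (λ x → (1 ≤? x) ×-dec (x ≤? length w)) w

record 𝔖 : Set where
  constructor perm
  field
    word : List ℕ
    .isPermutation : IsPermutation word

open 𝔖 public using (word)

valid : ∀ σ → IsPermutation (word σ)
valid (perm w v) = recompute (isPermutation? w) v

∣_∣ : 𝔖 → ℕ
∣ σ ∣ = length (word σ)

⟪_⟫ : (w : List ℕ) → {True (isPermutation? w)} → 𝔖
⟪ w ⟫ {t} = perm w (toWitness t)

[1…_] : ℕ → List ℕ
[1… n ] = applyUpTo suc n

ι : ℕ → 𝔖
ι r = perm [1… r ]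
  ( Unique.applyUpTo⁺₁ suc r (λ i<j _ → <⇒≢ (s≤s i<j))
  , All.applyUpTo⁺₁ suc r
      (λ i<r → s≤s z≤n , subst (_ ≤_) (sym (length-applyUpTo suc r)) i<r))

ε : 𝔖
ε = ι 0

p21 p213 p312 : 𝔖
p21  = ⟪ 2 ∷ 1 ∷ [] ⟫
p213 = ⟪ 2 ∷ 1 ∷ 3 ∷ [] ⟫
p312 = ⟪ 3 ∷ 1 ∷ 2 ∷ [] ⟫

------------------------------------------------------------------------
-- Pattern containment

SameOrder : List ℕ → List ℕ → Set
SameOrder xs ys = length xs ≡ length ys × All (λ a → All (Agree a) xys) xys
  where
  xys = zip xs ys
  Agree : ℕ × ℕ → ℕ × ℕ → Set
  Agree (x , y) (x′ , y′) = (x < x′ → y < y′) × (y < y′ → x < x′)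

_contains_ : 𝔖 → 𝔖 → Set
σ contains π = ∃ λ s → s ⊆ word σ × SameOrder s (word π)

_avoids_ : 𝔖 → 𝔖 → Set
σ avoids π = ¬ (σ contains π)

AvoidsAll : List 𝔖 → 𝔖 → Set
AvoidsAll Π σ = All (σ avoids_) Π

_∈𝔖_⟨_⟩ : 𝔖 → ℕ → List 𝔖 → Set
σ ∈𝔖 n ⟨ Π ⟩ = ∣ σ ∣ ≡ n × AvoidsAll Π σ

sameOrder? : ∀ xs ys → Dec (SameOrder xs ys)
sameOrder? xs ys = (length xs ≟ length ys) ×-dec
  All.all? (λ (x , y) → All.all? (λ (x′ , y′) →
    ((x <? x′) →-dec (y <? y′)) ×-dec ((y <? y′) →-dec (x <? x′))) (zip xs ys)) (zip xs ys)

someSublist? : {P : List ℕ → Set} → (∀ s → Dec (P s)) →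
               ∀ xs → Dec (∃ λ s → s ⊆ xs × P s)
someSublist? {P} P? [] = map′ (λ p → [] , [] , p) (λ { ([] , [] , p) → p }) (P? [])
someSublist? {P} P? (x ∷ xs) = map′
  [ (λ (s , s⊆ , p) → s , x ∷ʳ s⊆ , p) , (λ (s , s⊆ , p) → x ∷ s , refl ∷ s⊆ , p) ]′
  (λ { (s     , _ ∷ʳ s⊆   , p) → inj₁ (s , s⊆ , p)
     ; (_ ∷ s , refl ∷ s⊆ , p) → inj₂ (s , s⊆ , p) })
  (someSublist? P? xs ⊎-dec someSublist? (P? ∘ (x ∷_)) xs)

contains? : ∀ σ π → Dec (σ contains π)
contains? σ π = someSublist? (λ s → sameOrder? s (word π)) (word σ)

avoidsAll? : ∀ Π σ → Dec (AvoidsAll Π σ)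
avoidsAll? Π σ = All.all? (λ π → ¬? (contains? σ π)) Π

------------------------------------------------------------------------
-- The generating function

words : ℕ → List ℕ → List (List ℕ)
words zero    as = [] ∷ []
words (suc l) as = cartesianProductWith _∷_ as (words l as)

-- All permutations of {1,…,n}, each exactly once.
𝔖[_] : ℕ → List 𝔖
𝔖[ n ] = mapMaybe (λ w → Maybe.map (λ v → perm w v) (dec⇒maybe (isPermutation? w)))
                  (words n [1… n ])

F : (𝔖 → ℕ) → ℕ → List 𝔖 → ℤ[q]
F st n Π = ∑[ σ ∈ filter (avoidsAll? Π) 𝔖[ n ] ] (q^ st σ)

------------------------------------------------------------------------
-- Inflation.  A list of pairs (t , σ) records, from left to right, the
-- entries t of τ together with the permutations inflating them.

-- Total size of the blocks whose entry of τ is less than t, i.e. the amount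
-- by which the block inflating t is shifted up.
offset : List (ℕ × 𝔖) → ℕ → ℕ
offset []             t = 0
offset ((u , σ) ∷ ps) t with u <? t
... | yes _ = ∣ σ ∣ + offset ps t
... | no  _ = offset ps t

block : List (ℕ × 𝔖) → ℕ × 𝔖 → List ℕ
block ps (t , σ) = map (offset ps t +_) (word σ)

inflateWord : 𝔖 → List 𝔖 → List ℕ
inflateWord τ σs = concat (map (block ps) ps)
  where ps = zip (word τ) σs

private
  Pairs = List (ℕ × 𝔖)

  total : Pairs → ℕ
  total []             = 0
  total ((_ , σ) ∷ ps) = ∣ σ ∣ + total ps

  offset≤total : ∀ ps t → offset ps t ≤ total ps
  offset≤total []             t = z≤n
  offset≤total ((u , σ) ∷ ps) t with u <? t
  ... | yes _ = +-monoʳ-≤ ∣ σ ∣ (offset≤total ps t)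
  ... | no  _ = m≤n⇒m≤o+n ∣ σ ∣ (offset≤total ps t)

  offset-mono : ∀ ps {t t′} → t ≤ t′ → offset ps t ≤ offset ps t′
  offset-mono []             t≤t′ = z≤n
  offset-mono ((u , σ) ∷ ps) {t} {t′} t≤t′ with u <? t | u <? t′
  ... | yes _   | yes _    = +-monoʳ-≤ ∣ σ ∣ (offset-mono ps t≤t′)
  ... | yes u<t | no  u≮t′ = contradiction (<-≤-trans u<t t≤t′) u≮t′
  ... | no  _   | yes _    = m≤n⇒m≤o+n ∣ σ ∣ (offset-mono ps t≤t′)
  ... | no  _   | no  _    = offset-mono ps t≤t′

  swap+ : ∀ s {a b} m → a + s ≤ b → (m + a) + s ≤ m + b
  swap+ s {a} m h = ≤-trans (≤-reflexive (+-assoc m a s)) (+-monoʳ-≤ m h)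

  block≤total : ∀ {ps t σ} → (t , σ) ∈ ps → offset ps t + ∣ σ ∣ ≤ total ps
  block≤total {(u , ρ) ∷ ps} {t} {σ} (here refl) with u <? t
  ... | yes t<t = contradiction t<t (<-irrefl refl)
  ... | no  _   = ≤-trans (≤-reflexive (+-comm _ ∣ σ ∣)) (+-monoʳ-≤ ∣ σ ∣ (offset≤total ps t))
  block≤total {(u , ρ) ∷ ps} {t} {σ} (there p) with u <? t
  ... | yes _ = swap+ ∣ σ ∣ ∣ ρ ∣ (block≤total p)
  ... | no  _ = m≤n⇒m≤o+n ∣ ρ ∣ (block≤total p)

  block≤offset : ∀ {ps t σ t′} → (t , σ) ∈ ps → t < t′ → offset ps t + ∣ σ ∣ ≤ offset ps t′
  block≤offset {(u , ρ) ∷ ps} {t} {σ} {t′} (here refl) t<t′ with u <? t | u <? t′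
  ... | yes t<t | _       = contradiction t<t (<-irrefl refl)
  ... | no  _   | yes _   = ≤-trans (≤-reflexive (+-comm _ ∣ σ ∣))
                                    (+-monoʳ-≤ ∣ σ ∣ (offset-mono ps (<⇒≤ t<t′)))
  ... | no  _   | no u≮t′ = contradiction t<t′ u≮t′
  block≤offset {(u , ρ) ∷ ps} {t} {σ} {t′} (there p) t<t′ with u <? t | u <? t′
  ... | yes _   | yes _   = swap+ ∣ σ ∣ ∣ ρ ∣ (block≤offset p t<t′)
  ... | yes u<t | no u≮t′ = contradiction (<-trans u<t t<t′) u≮t′
  ... | no  _   | yes _   = m≤n⇒m≤o+n ∣ ρ ∣ (block≤offset p t<t′)
  ... | no  _   | no  _   = block≤offset p t<t′

  block-bounds : ∀ ps t σ → IsPermutation (word σ) → ∀ {x} → x ∈ block ps (t , σ) →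
                 offset ps t < x × x ≤ offset ps t + ∣ σ ∣
  block-bounds ps t σ (_ , b) x∈ with ∈-map⁻ (offset ps t +_) x∈
  ... | y , y∈ , refl with All.lookup b y∈
  ...   | 1≤y , y≤ = ≤-trans (≤-reflexive (+-comm 1 _)) (+-monoʳ-≤ (offset ps t) 1≤y)
                   , +-monoʳ-≤ (offset ps t) y≤

  AllValid : Pairs → Set
  AllValid = All (IsPermutation ∘ word ∘ proj₂)

  blocks-disjoint : ∀ ps → AllValid ps → ∀ {a b} → a ∈ ps → b ∈ ps → proj₁ a ≢ proj₁ b →
                    Disjoint (block ps a) (block ps b)
  blocks-disjoint ps vs {t , σ} {u , ρ} a∈ b∈ t≢u (x∈ , x∈′)
    with block-bounds ps t σ (All.lookup vs a∈) x∈
       | block-bounds ps u ρ (All.lookup vs b∈) x∈′ | <-cmp t u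
  ... | _ , x≤ | <x , _ | tri< t<u _ _ =
    <-irrefl refl (<-≤-trans <x (≤-trans x≤ (block≤offset a∈ t<u)))
  ... | _ | _ | tri≈ _ t≡u _ = t≢u t≡u
  ... | <x , _ | _ , x≤ | tri> _ _ u<t =
    <-irrefl refl (<-≤-trans <x (≤-trans x≤ (block≤offset b∈ u<t)))

  all-pairs : ∀ ps → AllValid ps → ∀ qs → (∀ {a} → a ∈ qs → a ∈ ps) →
              AllPairs (λ a b → proj₁ a ≢ proj₁ b) qs →
              AllPairs Disjoint (map (block ps) qs)
  all-pairs ps vs []       _   []         = []
  all-pairs ps vs (a ∷ qs) inc (a≢ ∷ rest) =
    All.map⁺ (All.tabulate λ b∈ →
      blocks-disjoint ps vs (inc (here refl)) (inc (there b∈)) (All.lookup a≢ b∈))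
    ∷ all-pairs ps vs qs (inc ∘ there) rest

  zip-distinct : ∀ {ts : List ℕ} (σs : List 𝔖) → Unique ts →
                 AllPairs (λ a b → proj₁ a ≢ proj₁ b) (zip ts σs)
  zip-distinct σs       []        = []
  zip-distinct []       (_ ∷ _)   = []
  zip-distinct (σ ∷ σs) (t≢ ∷ us) = head σs t≢ ∷ zip-distinct σs us
    where
    head : ∀ {t : ℕ} {ts} (σs : List 𝔖) → All (t ≢_) ts → All (λ b → t ≢ proj₁ b) (zip ts σs)
    head σs       []       = []
    head []       (_ ∷ _)  = []
    head (_ ∷ σs) (n ∷ ns) = n ∷ head σs ns

  length-blocks : ∀ ps qs → length (concat (map (block ps) qs)) ≡ total qs
  length-blocks ps []             = refl
  length-blocks ps ((t , σ) ∷ qs) =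
    trans (length-++ (block ps (t , σ)))
          (cong₂ _+_ (length-map (offset ps t +_) (word σ)) (length-blocks ps qs))

  blocks-valid : ∀ ps → AllValid ps → AllPairs (λ a b → proj₁ a ≢ proj₁ b) ps →
                 IsPermutation (concat (map (block ps) ps))
  blocks-valid ps vs ds =
      Unique.concat⁺ {xss = map (block ps) ps}
        (All.map⁺ (All.map (λ {(t , _)} v →
          Unique.map⁺ (+-cancelˡ-≡ (offset ps t) _ _) (proj₁ v)) vs))
        (all-pairs ps vs ps (λ a∈ → a∈) ds)
    , All.concat⁺ {xss = map (block ps) ps} (All.map⁺ (All.tabulate λ {(t , σ)} a∈ → All.tabulate λ x∈ →
        let (<x , x≤) = block-bounds ps t σ (All.lookup vs a∈) x∈ in
          ≤-trans (s≤s z≤n) <x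
        , ≤-trans x≤ (≤-trans (block≤total a∈)
                              (≤-reflexive (sym (length-blocks ps ps))))))

  allValid : ∀ τs σs → AllValid (zip τs σs)
  allValid []       _        = []
  allValid (_ ∷ _)  []       = []
  allValid (_ ∷ τs) (σ ∷ σs) = valid σ ∷ allValid τs σs

inflate : (τ : 𝔖) (σs : List 𝔖) → .(length σs ≡ ∣ τ ∣) → 𝔖
inflate τ σs _ = perm (inflateWord τ σs)
  (blocks-valid (zip (word τ) σs) (allValid (word τ) σs) (zip-distinct σs (proj₁ (valid τ))))

213[_,1,_] : 𝔖 → 𝔖 → 𝔖
213[ σ₁ ,1, σ₂ ] = inflate p213 (σ₁ ∷ ι 1 ∷ σ₂ ∷ []) refl

_* : 𝔖 → 𝔖
π * = inflate p21 (π ∷ ι 1 ∷ []) refl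

-- ι_r[π₁*,…,π_r*] for the list π₁,…,π_r
ι[_*] : List 𝔖 → 𝔖
ι[ πs *] = inflate (ι (length πs)) (map _* πs)
  (trans (length-map _* πs) (sym (length-applyUpTo suc (length πs))))

------------------------------------------------------------------------
-- Block decompositions

record BlockDecomposition (π : 𝔖) : Set where
  field
    blocks       : List 𝔖
    blocks-avoid : All (_avoids p312) blocks
    decomposes   : π ≡ ι[ blocks *]

  r : ℕ
  r = length blocks

open BlockDecomposition public using (blocks; r)

-- The permutations written π̲(i) and π̄(i), for the list of blocks of π and
-- 1 ≤ i ≤ r.  The values at other i are never used.
lower upper : List 𝔖 → ℕ → 𝔖
lower (π₁ ∷ _) 1 = π₁
lower πs       i = ι[ take i πs *]
upper πs       i = ι[ drop (i ∸ 1) πs *]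

module _ {m : ℕ} {π : Fin m → 𝔖} (d : ∀ j → BlockDecomposition (π j)) where

  lowerΠ upperΠ : Vec ℕ m → List 𝔖
  lowerΠ I = p312 ∷ tabulate (λ j → lower (blocks (d j)) (Vec.lookup I j))
  upperΠ I = p312 ∷ tabulate (λ j → upper (blocks (d j)) (Vec.lookup I j))

------------------------------------------------------------------------
-- Index sets of the sums

subsets : ∀ m → List (Subset m)
subsets zero    = [] ∷ []
subsets (suc m) = cartesianProductWith _∷_ (outside ∷ inside ∷ []) (subsets m)

δ : ∀ {m} → Subset m → Vec ℕ m
δ = Vec.map λ { inside → 1 ; outside → 0 }

-- All I = (i₁,…,iₘ) with 1 ≤ i_j ≤ b_j for the given bounds b.
tuples : ∀ {m} → Vec ℕ m → List (Vec ℕ m)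
tuples []       = [] ∷ []
tuples (b ∷ bs) = cartesianProductWith _∷_ [1… b ] (tuples bs)

_+ᵥ_ : ∀ {m} → Vec ℕ m → Vec ℕ m → Vec ℕ m
_+ᵥ_ = Vec.zipWith _+_

-- The tuples with 1 ≤ i_j ≤ r_j − δ_j.  Truncated subtraction is harmless:
-- it differs from subtraction only for r_j = 0, δ_j = 1, and then no i_j
-- exists in either reading.
indices : ∀ {m} {π : Fin m → 𝔖} → (∀ j → BlockDecomposition (π j)) → Subset m → List (Vec ℕ m)
indices d S = tuples (Vec.zipWith _∸_ (Vec.tabulate (λ j → r (d j))) (δ S))

{-# OPTIONS --safe #-}
module Submission where

-- A 312-avoiding permutation of length n + 1 is 213[σ₁,1,σ₂] for a unique pair
-- of 312-avoiders.  Since every block πᵢ* ends with its least entry, an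
-- occurrence of π = ι_r[π₁*,…,π_r*] in it is cut at a block boundary; hence
-- 213[σ₁,1,σ₂] avoids π iff, for some 1 ≤ i ≤ r, σ₁ avoids π̲(i) and σ₂ avoids
-- π̄(i).  These i form an interval, and the number of its points minus the
-- number of its pairs of neighbours is 1 or 0 according to whether it is
-- nonempty.  The product of these differences over all j, expanded, is the
-- signed sum over S and I.

open import Defs
open import Data.Bool using (Bool; true; false; _∧_; _∨_)
open import Data.Bool.Properties using (∧-identityʳ; ∧-zeroʳ; ∨-identityʳ)
open import Data.Fin using (Fin; zero; suc; fromℕ<)
open import Data.Fin.Properties using (injective⇒≤; fromℕ<-injective)
open import Data.Fin.Subset using (Subset; inside; outside) renaming (∣_∣ to card)
open import Data.Integer using (ℤ; 0ℤ; 1ℤ; -1ℤ)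
  renaming (_+_ to _+ᶻ_; _*_ to _*ᶻ_; _-_ to _-ᶻ_; _^_ to _^ℤ_)
import Data.Integer.Properties as ℤ
open import Data.Integer.Tactic.RingSolver using (solve-∀)
open import Data.List using
  (List; []; _∷_; _++_; length; lookup; map; concat; concatMap; mapMaybe; filter; take; drop;
   zip; tabulate; applyUpTo; upTo; cartesianProduct; cartesianProductWith)
open import Data.List.Properties using
  (length-map; length-++; map-++; map-∘; map-cong; map-id; map-id-local; map-injective;
   ++-assoc; ++-identityʳ; ∷-injective; ∷ʳ-injectiveˡ; take++drop≡id; drop-all;
   filter-accept; filter-reject)
import Data.List.Membership.DecPropositional as DecMembership
open import Data.List.Membership.Propositional using (_∈_)
open import Data.List.Membership.Propositional.Properties using
  (∈-map⁺; ∈-map⁻; ∈-++⁺ˡ; ∈-++⁺ʳ; ∈-++⁻; ∈-∃++; ∈-lookup; ∈-filter⁺; ∈-filter⁻; ∈-concat⁺′;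
   ∈-concat⁻′; ∈-cartesianProductWith⁺; ∈-cartesianProductWith⁻; ∈-cartesianProduct⁺;
   ∈-cartesianProduct⁻; ∈-applyUpTo⁺; ∈-upTo⁺; ∈-upTo⁻)
open import Data.List.Membership.Propositional.Properties.WithK using (unique∧set⇒bag)
open import Data.List.Relation.Binary.BagAndSetEquality using (∼bag⇒↭)
open import Data.List.Relation.Binary.Disjoint.Propositional using (Disjoint)
open import Data.List.Relation.Binary.Permutation.Propositional as Perm using (_↭_)
open import Data.List.Relation.Binary.Sublist.Propositional as Sub
  using (_⊆_; []; _∷ʳ_; _∷_; ⊆-refl; ⊆-trans)
import Data.List.Relation.Binary.Sublist.Propositional.Properties as Sub
open import Data.List.Relation.Unary.All as All using (All; []; _∷_)
import Data.List.Relation.Unary.All.Properties as All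
open import Data.List.Relation.Unary.AllPairs as AllPairs using ([]; _∷_)
import Data.List.Relation.Unary.AllPairs.Properties as AllPairs
open import Data.List.Relation.Unary.Any using (here; there)
open import Data.List.Relation.Unary.Unique.Propositional using (Unique)
import Data.List.Relation.Unary.Unique.Propositional.Properties as Unique
open import Data.Maybe as Maybe using ()
open import Data.Nat using
  (ℕ; zero; suc; pred; _+_; _∸_; _≤_; _<_; _≤?_; _<?_; _≟_; z≤n; s≤s; s≤s⁻¹)
open import Data.Nat.Properties hiding (_≤?_; _<?_; _≟_)
open import Data.Product using (∃; ∃₂; ∃-syntax; _×_; _,_; proj₁; proj₂; map₁; map₂)
open import Data.Sum using (_⊎_; inj₁; inj₂)
open import Data.Vec as Vec using (Vec; []; _∷_)
open import Function using (_∘_; id; mk⇔)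
open import Relation.Binary.Definitions using (tri<; tri≈; tri>)
open import Relation.Binary.PropositionalEquality
open import Relation.Nullary using (¬_; Dec; does; yes; no; ¬?; contradiction)
open import Relation.Nullary.Decidable using (dec⇒maybe; dec-true)
open import Relation.Unary using (Decidable)

-- Occurrences of patterns

-- The obstacle is that "some i works" is not the product of a condition on σ₁ and a condition on
-- σ₂, so summing it over pairs does not give a product of generating functions. For a single index
-- i it is one: the indicator is a(i) b(i), where a(i) records that σ₁ avoids π̲(i) and b(i) that σ₂
-- avoids π̄(i). As i grows, the patterns π̲(i) grow and the patterns π̄(i) shrink, so a can only
-- switch from 0 to 1 and b only from 1 to 0. This makes the good indices an interval. It also
-- reduces the indicator of two good neighbours i and i+1 to a(i) b(i+1), again a product. That is
-- the origin of the shift δ, and the reason why it affects the upper patterns alone. The index is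
-- chosen for each pattern independently, which is why tuples I and subsets S appear once all
-- patterns are treated together.

Agree : ℕ × ℕ → ℕ × ℕ → Set
Agree (x , y) (x′ , y′) = (x < x′ → y < y′) × (y < y′ → x < x′)

infix 4 _≼_ _≪_

-- An occurrence of the pattern p in the word w, as the list of pairs
-- (entry of w , entry of p).
_≼_ : List ℕ → List ℕ → Set
p ≼ w = ∃ λ zs → map proj₁ zs ⊆ w × map proj₂ zs ≡ p × (∀ {a b} → a ∈ zs → b ∈ zs → Agree a b)

_≪_ : List ℕ → List ℕ → Set
xs ≪ ys = ∀ {x y} → x ∈ xs → y ∈ ys → x < y

map-proj₁-zip : ∀ {A B : Set} (xs : List A) (ys : List B) →
                length xs ≡ length ys → map proj₁ (zip xs ys) ≡ xs
map-proj₁-zip []       _        _  = refl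
map-proj₁-zip (x ∷ xs) (y ∷ ys) eq = cong (x ∷_) (map-proj₁-zip xs ys (suc-injective eq))

map-proj₂-zip : ∀ {A B : Set} (xs : List A) (ys : List B) →
                length xs ≡ length ys → map proj₂ (zip xs ys) ≡ ys
map-proj₂-zip []       []       _  = refl
map-proj₂-zip (x ∷ xs) (y ∷ ys) eq = cong (y ∷_) (map-proj₂-zip xs ys (suc-injective eq))

zip-map-proj : ∀ {A B : Set} (zs : List (A × B)) → zip (map proj₁ zs) (map proj₂ zs) ≡ zs
zip-map-proj []       = refl
zip-map-proj (z ∷ zs) = cong (z ∷_) (zip-map-proj zs)

contains⇒≼ : ∀ {σ π} → σ contains π → word π ≼ word σ
contains⇒≼ {σ} {π} (s , s⊆ , len , agree) =
    zip s (word π)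
  , subst (_⊆ word σ) (sym (map-proj₁-zip s (word π) len)) s⊆
  , map-proj₂-zip s (word π) len
  , λ a∈ b∈ → All.lookup (All.lookup agree a∈) b∈

≼⇒contains : ∀ {σ π} → word π ≼ word σ → σ contains π
≼⇒contains (zs , s⊆ , refl , agree) =
    map proj₁ zs , s⊆
  , trans (length-map proj₁ zs) (sym (length-map proj₂ zs))
  , subst (λ l → All (λ a → All (Agree a) l) l) (sym (zip-map-proj zs))
      (All.tabulate λ a∈ → All.tabulate λ b∈ → agree a∈ b∈)

[]≼ : ∀ {w} → [] ≼ w
[]≼ = [] , Sub.minimum _ , refl , λ ()

≼-⊆ : ∀ {p w w′} → p ≼ w → w ⊆ w′ → p ≼ w′
≼-⊆ (zs , s⊆ , eq , agree) w⊆ = zs , ⊆-trans s⊆ w⊆ , eq , agree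

unmap-⊆ : ∀ {A B : Set} (f : A → B) {ys} xs → ys ⊆ map f xs → ∃ λ zs → zs ⊆ xs × map f zs ≡ ys
unmap-⊆ f []       []          = [] , [] , refl
unmap-⊆ f (x ∷ xs) (_ ∷ʳ s)    with unmap-⊆ f xs s
... | zs , zs⊆ , eq = zs , x ∷ʳ zs⊆ , eq
unmap-⊆ f (x ∷ xs) (refl ∷ s)  with unmap-⊆ f xs s
... | zs , zs⊆ , eq = x ∷ zs , refl ∷ zs⊆ , cong (f x ∷_) eq

⊆-≼ : ∀ {p p′ w} → p′ ⊆ p → p ≼ w → p′ ≼ w
⊆-≼ p′⊆ (zs , s⊆ , refl , agree) with unmap-⊆ proj₂ zs p′⊆
... | zs′ , zs′⊆ , eq = zs′ , ⊆-trans (Sub.map⁺ proj₁ zs′⊆) s⊆ , eq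
                      , λ a∈ b∈ → agree (Sub.lookup zs′⊆ a∈) (Sub.lookup zs′⊆ b∈)

-- Only relative order matters for `≼`, so pieces of a word serve as patterns without being
-- standardised. The condition is restricted to the entries of `l` because truncated subtraction of
-- `c`, which undoes raising by `c`, does not preserve strict order below `c`.
OrderEmbedding : (ℕ → ℕ) → List ℕ → Set
OrderEmbedding g l = ∀ {x y} → x ∈ l → y ∈ l → (x < y → g x < g y) × (g x < g y → x < y)

≼-map-pattern : ∀ {p w} g → OrderEmbedding g p → p ≼ w → map g p ≼ w
≼-map-pattern {w = w} g emb (zs , s⊆ , refl , agree) =
    map (map₂ g) zs
  , subst (_⊆ w) (map-∘ zs) s⊆
  , trans (sym (map-∘ zs)) (map-∘ zs)
  , λ a∈ b∈ → agree′ (∈-map⁻ (map₂ g) a∈) (∈-map⁻ (map₂ g) b∈)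
  where
  agree′ : ∀ {a b} → (∃ λ a′ → a′ ∈ zs × a ≡ map₂ g a′) → (∃ λ b′ → b′ ∈ zs × b ≡ map₂ g b′) → Agree a b
  agree′ (a , a∈ , refl) (b , b∈ , refl) =
    let (to , from) = agree a∈ b∈
        (to′ , from′) = emb (∈-map⁺ proj₂ a∈) (∈-map⁺ proj₂ b∈)
    in to′ ∘ to , from ∘ from′

≼-map-text : ∀ {p w} g → OrderEmbedding g w → p ≼ w → p ≼ map g w
≼-map-text {w = w} g emb (zs , s⊆ , refl , agree) =
    map (map₁ g) zs
  , subst (_⊆ map g w) (trans (sym (map-∘ zs)) (map-∘ zs)) (Sub.map⁺ g s⊆)
  , sym (map-∘ zs)
  , λ a∈ b∈ → agree′ (∈-map⁻ (map₁ g) a∈) (∈-map⁻ (map₁ g) b∈)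
  where
  agree′ : ∀ {a b} → (∃ λ a′ → a′ ∈ zs × a ≡ map₁ g a′) → (∃ λ b′ → b′ ∈ zs × b ≡ map₁ g b′) → Agree a b
  agree′ (a , a∈ , refl) (b , b∈ , refl) =
    let (to , from) = agree a∈ b∈
        (to′ , from′) = emb (Sub.lookup s⊆ (∈-map⁺ proj₁ a∈)) (Sub.lookup s⊆ (∈-map⁺ proj₁ b∈))
    in to ∘ from′ , to′ ∘ from

shift-embedding : ∀ c l → OrderEmbedding (c +_) l
shift-embedding c l _ _ = +-monoʳ-< c , +-cancelˡ-< c _ _

unshift-embedding : ∀ c l → OrderEmbedding (_∸ c) (map (c +_) l)
unshift-embedding c l x∈ y∈ with ∈-map⁻ (c +_) x∈ | ∈-map⁻ (c +_) y∈
... | x , _ , refl | y , _ , refl rewrite m+n∸m≡n c x | m+n∸m≡n c y =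
  +-cancelˡ-< c _ _ , +-monoʳ-< c

unshift-shift : ∀ c l → map (_∸ c) (map (c +_) l) ≡ l
unshift-shift c l = trans (sym (map-∘ l)) (trans (map-cong (m+n∸m≡n c) l) (map-id l))

module _ {p w : List ℕ} (c : ℕ) where

  shift-pattern : p ≼ w → map (c +_) p ≼ w
  shift-pattern = ≼-map-pattern (c +_) (shift-embedding c p)

  unshift-pattern : map (c +_) p ≼ w → p ≼ w
  unshift-pattern = subst (_≼ w) (unshift-shift c p) ∘ ≼-map-pattern (_∸ c) (unshift-embedding c p)

  shift-text : p ≼ w → p ≼ map (c +_) w
  shift-text = ≼-map-text (c +_) (shift-embedding c w)

  unshift-text : p ≼ map (c +_) w → p ≼ w
  unshift-text = subst (p ≼_) (unshift-shift c w) ∘ ≼-map-text (_∸ c) (unshift-embedding c w)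

⊆-++⁻ : ∀ {A B : Set} (f : A → B) u {v} zs → map f zs ⊆ u ++ v →
        ∃₂ λ zs₁ zs₂ → zs ≡ zs₁ ++ zs₂ × map f zs₁ ⊆ u × map f zs₂ ⊆ v
⊆-++⁻ f []      zs       s          = [] , zs , refl , [] , s
⊆-++⁻ f (x ∷ u) []       _          = [] , [] , refl , Sub.minimum _ , Sub.minimum _
⊆-++⁻ f (x ∷ u) (z ∷ zs) (_ ∷ʳ s)   with ⊆-++⁻ f u (z ∷ zs) s
... | zs₁ , zs₂ , eq , s₁ , s₂ = zs₁ , zs₂ , eq , x ∷ʳ s₁ , s₂
⊆-++⁻ f (x ∷ u) (z ∷ zs) (eq₀ ∷ s) with ⊆-++⁻ f u zs s
... | zs₁ , zs₂ , eq , s₁ , s₂ = z ∷ zs₁ , zs₂ , cong (z ∷_) eq , eq₀ ∷ s₁ , s₂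

-- The two halves alone forget how entries left and right of the seam compare. The last component
-- keeps this: `x` and `x′` are the text entries standing for `y` and `y′`, and both `u ≪ v` and the
-- minimality of a final 1 are applied to them.
≼-++⁻ : ∀ {p} u {v} → p ≼ u ++ v → ∃₂ λ p₁ p₂ → p ≡ p₁ ++ p₂ × p₁ ≼ u × p₂ ≼ v ×
        (∀ {y y′} → y ∈ p₁ → y′ ∈ p₂ → ∃₂ λ x x′ → x ∈ u × x′ ∈ v ×
           Agree (x , y) (x′ , y′) × Agree (x′ , y′) (x , y))
≼-++⁻ u (zs , s⊆ , refl , agree) with ⊆-++⁻ proj₁ u zs s⊆
... | zs₁ , zs₂ , refl , s₁ , s₂ =
    map proj₂ zs₁ , map proj₂ zs₂ , map-++ proj₂ zs₁ zs₂
  , (zs₁ , s₁ , refl , λ a∈ b∈ → agree (∈-++⁺ˡ a∈) (∈-++⁺ˡ b∈))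
  , (zs₂ , s₂ , refl , λ a∈ b∈ → agree (∈-++⁺ʳ zs₁ a∈) (∈-++⁺ʳ zs₁ b∈))
  , λ y∈ y′∈ → cross (∈-map⁻ proj₂ y∈) (∈-map⁻ proj₂ y′∈)
  where
  cross : ∀ {y y′} → (∃ λ a → a ∈ zs₁ × y ≡ proj₂ a) → (∃ λ b → b ∈ zs₂ × y′ ≡ proj₂ b) →
          ∃₂ λ x x′ → x ∈ _ × x′ ∈ _ × Agree (x , y) (x′ , y′) × Agree (x′ , y′) (x , y)
  cross (a , a∈ , refl) (b , b∈ , refl) =
      proj₁ a , proj₁ b , Sub.lookup s₁ (∈-map⁺ proj₁ a∈) , Sub.lookup s₂ (∈-map⁺ proj₁ b∈)
    , agree (∈-++⁺ˡ a∈) (∈-++⁺ʳ zs₁ b∈) , agree (∈-++⁺ʳ zs₁ b∈) (∈-++⁺ˡ a∈)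

≼-++⁻-≪ : ∀ {p} u {v} → u ≪ v → p ≼ u ++ v →
          ∃₂ λ p₁ p₂ → p ≡ p₁ ++ p₂ × p₁ ≼ u × p₂ ≼ v × p₁ ≪ p₂
≼-++⁻-≪ u u≪v occ with ≼-++⁻ u occ
... | p₁ , p₂ , eq , o₁ , o₂ , cross = p₁ , p₂ , eq , o₁ , o₂ , λ y∈ y′∈ →
  let (x , x′ , x∈ , x′∈ , agr , _) = cross y∈ y′∈ in proj₁ agr (u≪v x∈ x′∈)

≼-++⁺ : ∀ {p₁ p₂ u v} → p₁ ≪ p₂ → u ≪ v → p₁ ≼ u → p₂ ≼ v → p₁ ++ p₂ ≼ u ++ v
≼-++⁺ p≪ u≪ (zs₁ , s₁ , refl , agree₁) (zs₂ , s₂ , refl , agree₂) =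
    zs₁ ++ zs₂
  , subst (_⊆ _) (sym (map-++ proj₁ zs₁ zs₂)) (Sub.++⁺ s₁ s₂)
  , map-++ proj₂ zs₁ zs₂
  , λ a∈ b∈ → agree (∈-++⁻ zs₁ a∈) (∈-++⁻ zs₁ b∈)
  where
  agree : ∀ {a b} → a ∈ zs₁ ⊎ a ∈ zs₂ → b ∈ zs₁ ⊎ b ∈ zs₂ → Agree a b
  agree (inj₁ a∈) (inj₁ b∈) = agree₁ a∈ b∈
  agree (inj₂ a∈) (inj₂ b∈) = agree₂ a∈ b∈
  agree (inj₁ a∈) (inj₂ b∈) =
      (λ _ → p≪ (∈-map⁺ proj₂ a∈) (∈-map⁺ proj₂ b∈))
    , (λ _ → u≪ (Sub.lookup s₁ (∈-map⁺ proj₁ a∈)) (Sub.lookup s₂ (∈-map⁺ proj₁ b∈)))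
  agree (inj₂ a∈) (inj₁ b∈) =
      (λ lt → contradiction
        (<-trans lt (u≪ (Sub.lookup s₁ (∈-map⁺ proj₁ b∈)) (Sub.lookup s₂ (∈-map⁺ proj₁ a∈))))
        (<-irrefl refl))
    , (λ lt → contradiction (<-trans lt (p≪ (∈-map⁺ proj₂ b∈) (∈-map⁺ proj₂ a∈))) (<-irrefl refl))

≼-singleton : ∀ {p c} → p ≼ c ∷ [] → p ≡ [] ⊎ ∃ λ e → p ≡ e ∷ []
≼-singleton ([]         , _               , refl , _) = inj₁ refl
≼-singleton (z ∷ []     , _               , refl , _) = inj₂ (_ , refl)
≼-singleton (_ ∷ _ ∷ _  , _ ∷ʳ ()         , refl , _)
≼-singleton (_ ∷ _ ∷ _  , _ ∷ ()          , refl , _)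

-- Block decompositions

-- The word of ι[ πs *] with all values raised by c.
blockWord : ℕ → List 𝔖 → List ℕ
blockWord c []       = []
blockWord c (π ∷ πs) = map (c +_) (word (π *)) ++ blockWord (c + ∣ π * ∣) πs

blockLength : List 𝔖 → ℕ
blockLength []       = 0
blockLength (π ∷ πs) = ∣ π * ∣ + blockLength πs

blockWord-++ : ∀ c πs ρs → blockWord c (πs ++ ρs) ≡ blockWord c πs ++ blockWord (c + blockLength πs) ρs
blockWord-++ c []       ρs rewrite +-identityʳ c = refl
blockWord-++ c (π ∷ πs) ρs rewrite blockWord-++ (c + ∣ π * ∣) πs ρs | +-assoc c ∣ π * ∣ (blockLength πs) =
  sym (++-assoc (map (c +_) (word (π *))) _ _)

blockWord-shift : ∀ c e πs → blockWord (c + e) πs ≡ map (c +_) (blockWord e πs)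
blockWord-shift c e []       = refl
blockWord-shift c e (π ∷ πs) = begin
  map (c + e +_) (word (π *)) ++ blockWord (c + e + ∣ π * ∣) πs
    ≡⟨ cong₂ _++_ (trans (map-cong (+-assoc c e) (word (π *))) (map-∘ (word (π *))))
         (trans (cong (λ x → blockWord x πs) (+-assoc c e _)) (blockWord-shift c (e + ∣ π * ∣) πs)) ⟩
  map (c +_) (map (e +_) (word (π *))) ++ map (c +_) (blockWord (e + ∣ π * ∣) πs)
    ≡⟨ map-++ (c +_) (map (e +_) (word (π *))) _ ⟨
  map (c +_) (blockWord e (π ∷ πs)) ∎
  where open ≡-Reasoning

blockWord-shift₀ : ∀ c πs → blockWord c πs ≡ map (c +_) (blockWord 0 πs)
blockWord-shift₀ c πs = trans (cong (λ x → blockWord x πs) (sym (+-identityʳ c))) (blockWord-shift c 0 πs)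

word-bounds : ∀ σ {x} → x ∈ word σ → 1 ≤ x × x ≤ ∣ σ ∣
word-bounds σ = All.lookup (proj₂ (valid σ))

shifted-bounds : ∀ c σ {x} → x ∈ map (c +_) (word σ) → c < x × x ≤ c + ∣ σ ∣
shifted-bounds c σ x∈ with ∈-map⁻ (c +_) x∈
... | y , y∈ , refl = let (1≤y , y≤) = word-bounds σ y∈ in
  ≤-trans (≤-reflexive (+-comm 1 c)) (+-monoʳ-≤ c 1≤y) , +-monoʳ-≤ c y≤

blockWord-bounds : ∀ c πs {x} → x ∈ blockWord c πs → c < x × x ≤ c + blockLength πs
blockWord-bounds c (π ∷ πs) x∈ with ∈-++⁻ (map (c +_) (word (π *))) x∈
... | inj₁ x∈₁ = let (<x , x≤) = shifted-bounds c (π *) x∈₁ in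
  <x , ≤-trans x≤ (+-monoʳ-≤ c (m≤m+n ∣ π * ∣ (blockLength πs)))
... | inj₂ x∈₂ = let (<x , x≤) = blockWord-bounds (c + ∣ π * ∣) πs x∈₂ in
  ≤-<-trans (m≤m+n c ∣ π * ∣) <x , ≤-trans x≤ (≤-reflexive (+-assoc c _ _))

blockWord-≪ : ∀ c πs ρs → blockWord c πs ≪ blockWord (c + blockLength πs) ρs
blockWord-≪ c πs ρs x∈ y∈ =
  ≤-<-trans (proj₂ (blockWord-bounds c πs x∈)) (proj₁ (blockWord-bounds _ ρs y∈))

-- Read as 12[σ₁*, σ₂], the permutation has all its smaller values on the left. Occurrences are
-- split and joined in this two-part form.
word-213 : ∀ σ₁ σ₂ → word 213[ σ₁ ,1, σ₂ ] ≡ word (σ₁ *) ++ map ((∣ σ₁ ∣ + 1) +_) (word σ₂)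
word-213 σ₁ σ₂ = begin
  word 213[ σ₁ ,1, σ₂ ]
    -- On 213, `offset` evaluates to the shifts 1, 0 and `∣ σ₁ ∣ + 1`, so only the empty tail left
    -- by `concat` has to be removed.
    ≡⟨ cong (λ z → map suc (word σ₁) ++ 1 ∷ z) (++-identityʳ (map ((∣ σ₁ ∣ + 1) +_) (word σ₂))) ⟩
  map suc (word σ₁) ++ 1 ∷ map ((∣ σ₁ ∣ + 1) +_) (word σ₂)
    ≡⟨ ++-assoc (map suc (word σ₁)) (1 ∷ []) _ ⟨
  word (σ₁ *) ++ map ((∣ σ₁ ∣ + 1) +_) (word σ₂) ∎
  where open ≡-Reasoning

length-star : ∀ σ → ∣ σ * ∣ ≡ ∣ σ ∣ + 1
length-star σ = trans (length-++ (map suc (word σ))) (cong (_+ 1) (length-map suc (word σ)))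

star-≪ : ∀ σ₁ σ₂ → word (σ₁ *) ≪ map ((∣ σ₁ ∣ + 1) +_) (word σ₂)
star-≪ σ₁ σ₂ x∈ y∈ = ≤-<-trans
  (≤-trans (proj₂ (word-bounds (σ₁ *) x∈)) (≤-reflexive (length-star σ₁)))
  (proj₁ (shifted-bounds (∣ σ₁ ∣ + 1) σ₂ y∈))

≼-213⁻ : ∀ {p} σ₁ σ₂ → p ≼ word 213[ σ₁ ,1, σ₂ ] →
         ∃₂ λ p₁ p₂ → p ≡ p₁ ++ p₂ × p₁ ≼ word (σ₁ *) × p₂ ≼ word σ₂ × p₁ ≪ p₂
≼-213⁻ σ₁ σ₂ occ with ≼-++⁻-≪ (word (σ₁ *)) (star-≪ σ₁ σ₂) (subst (_ ≼_) (word-213 σ₁ σ₂) occ)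
... | p₁ , p₂ , eq , o₁ , o₂ , p≪ = p₁ , p₂ , eq , o₁ , unshift-text (∣ σ₁ ∣ + 1) o₂ , p≪

≼-213⁺ : ∀ {p₁ p₂} σ₁ σ₂ → p₁ ≪ p₂ → p₁ ≼ word (σ₁ *) → p₂ ≼ word σ₂ →
         p₁ ++ p₂ ≼ word 213[ σ₁ ,1, σ₂ ]
≼-213⁺ σ₁ σ₂ p≪ o₁ o₂ = subst (_ ≼_) (sym (word-213 σ₁ σ₂))
  (≼-++⁺ p≪ (star-≪ σ₁ σ₂) o₁ (shift-text (∣ σ₁ ∣ + 1) o₂))

++-split : ∀ {A : Set} (as bs cs ds : List A) → as ++ bs ≡ cs ++ ds →
           (∃ λ ts → cs ≡ as ++ ts × bs ≡ ts ++ ds) ⊎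
           (∃₂ λ t ts → as ≡ cs ++ t ∷ ts × ds ≡ t ∷ ts ++ bs)
++-split []       bs cs       ds eq = inj₁ (cs , refl , eq)
++-split (a ∷ as) bs []       ds eq = inj₂ (a , as , refl , sym eq)
++-split (a ∷ as) bs (c ∷ cs) ds eq with ∷-injective eq
... | refl , eq′ with ++-split as bs cs ds eq′
...   | inj₁ (ts , p , q)     = inj₁ (ts , cong (a ∷_) p , q)
...   | inj₂ (t , ts , p , q) = inj₂ (t , ts , cong (a ∷_) p , q)

last∈ : ∀ {A : Set} (as bs : List A) {l : A} {t ts} → as ++ l ∷ [] ≡ bs ++ t ∷ ts → l ∈ t ∷ ts
last∈ []       []       refl = here refl
last∈ []       (b ∷ []) ()
last∈ []       (b ∷ _ ∷ _) ()
last∈ (a ∷ as) []       refl = there (∈-++⁺ʳ as (here refl))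
last∈ (a ∷ as) (b ∷ bs) eq   = last∈ as bs (proj₂ (∷-injective eq))

-- The last entry of a block is its least one, so a cut with smaller values on
-- the left cannot run through a block.
blockWord-cut : ∀ c πs p₁ p₂ → blockWord c πs ≡ p₁ ++ p₂ → p₁ ≪ p₂ →
                ∃ λ j → p₁ ≡ blockWord c (take j πs) ×
                        p₂ ≡ blockWord (c + blockLength (take j πs)) (drop j πs)
blockWord-cut c πs [] p₂ eq p≪ = 0 , refl , trans (sym eq) (cong (λ x → blockWord x πs) (sym (+-identityʳ c)))
blockWord-cut c [] (_ ∷ _) p₂ () p≪
blockWord-cut c (π ∷ πs) p₁@(x ∷ _) p₂ eq p≪
  with ++-split (map (c +_) (word (π *))) (blockWord (c + ∣ π * ∣) πs) p₁ p₂ eq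
... | inj₁ (ts , p₁≡ , eq′) = cut p₁≡ (blockWord-cut (c + ∣ π * ∣) πs ts p₂ eq′ λ x∈ →
                                p≪ (subst (_ ∈_) (sym p₁≡) (∈-++⁺ʳ (map (c +_) (word (π *))) x∈)))
  where
  cut : p₁ ≡ map (c +_) (word (π *)) ++ ts → _ → _
  cut p₁≡ (j , q₁ , q₂) = suc j , trans p₁≡ (cong (_ ++_) q₁)
    , trans q₂ (cong (λ x → blockWord x (drop j πs)) (+-assoc c _ _))
... | inj₂ (t , ts , b≡ , p₂≡) = contradiction
        (<-≤-trans (p≪ (here refl) c+1∈) (subst (_≤ x) (+-comm 1 c) c<x)) (<-irrefl refl)
  where
  c<x : c < x
  c<x = proj₁ (shifted-bounds c (π *) (subst (x ∈_) (sym b≡) (here refl)))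
  c+1∈ : c + 1 ∈ p₂
  c+1∈ = subst (_ ∈_) (sym p₂≡) (∈-++⁺ˡ (last∈ (map (c +_) (map suc (word π))) p₁
           (trans (sym (map-++ (c +_) (map suc (word π)) (1 ∷ []))) b≡)))

-- If 1 occurs in the pattern but not at its end, the pattern cannot use the
-- final 1 of σ*.
≼-star⁻ : ∀ {p} σ s t {ts} → p ≡ s ++ 1 ∷ t ∷ ts → (∀ {x} → x ∈ p → 1 ≤ x) →
          p ≼ word (σ *) → p ≼ word σ
≼-star⁻ {p} σ s t {ts} p≡ pos occ with ≼-++⁻ (map suc (word σ)) occ
... | p₁ , p₂ , eq , o₁ , o₂ , cross with ≼-singleton o₂
...   | inj₁ refl = unshift-text 1 (subst (_≼ _) (sym (trans eq (++-identityʳ p₁))) o₁)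
...   | inj₂ (e , refl) = contradiction e<1 (≤⇒≯ (pos (subst (e ∈_) (sym eq) (∈-++⁺ʳ p₁ (here refl)))))
  where
  1∈p₁ : 1 ∈ p₁
  1∈p₁ with ++-split p₁ (e ∷ []) (s ++ 1 ∷ []) (t ∷ ts)
              (trans (sym eq) (trans p≡ (sym (++-assoc s (1 ∷ []) _))))
  ... | inj₁ ([] , q , _)    = subst (1 ∈_) (trans q (++-identityʳ p₁)) (∈-++⁺ʳ s (here refl))
  ... | inj₁ (_ ∷ [] , _ , ())
  ... | inj₁ (_ ∷ _ ∷ _ , _ , ())
  ... | inj₂ (_ , _ , q , _) = subst (1 ∈_) (sym q) (∈-++⁺ˡ (∈-++⁺ʳ s (here refl)))
  e<1 : e < 1
  e<1 with cross 1∈p₁ (here refl)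
  ... | x , .1 , x∈ , here refl , _ , agr with ∈-map⁻ suc x∈
  ...   | x′ , x′∈ , refl = proj₁ agr (s≤s (proj₁ (word-bounds σ x′∈)))

⊆-star : ∀ σ → map suc (word σ) ⊆ word (σ *)
⊆-star σ = Sub.++⁺ʳ (1 ∷ []) ⊆-refl

star≼star⁻ : ∀ π σ → word (π *) ≼ word (σ *) → word π ≼ word σ
star≼star⁻ π σ occ with ≼-++⁻ (map suc (word σ)) occ
... | p₁ , p₂ , eq , o₁ , o₂ , _ with ≼-singleton o₂
...   | inj₁ refl = unshift-pattern 1 (unshift-text 1
          (⊆-≼ (subst (_ ⊆_) (trans eq (++-identityʳ p₁)) (⊆-star π)) o₁))
...   | inj₂ (e , refl) = unshift-pattern 1 (unshift-text 1 (subst (_≼ _) (sym (∷ʳ-inj eq)) o₁))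
  where
  ∷ʳ-inj : map suc (word π) ++ 1 ∷ [] ≡ p₁ ++ e ∷ [] → map suc (word π) ≡ p₁
  ∷ʳ-inj = ∷ʳ-injectiveˡ _ _

star≼star⁺ : ∀ π σ → word π ≼ word σ → word (π *) ≼ word (σ *)
star≼star⁺ π σ (zs , s⊆ , eq , agree) =
    map sucs zs ++ (1 , 1) ∷ []
  , subst (_⊆ word (σ *))
      (trans (cong (_++ 1 ∷ []) (trans (sym (map-∘ zs)) (map-∘ zs))) (sym (map-++ proj₁ (map sucs zs) _)))
      (Sub.++⁺ (Sub.map⁺ suc s⊆) ⊆-refl)
  , trans (map-++ proj₂ (map sucs zs) _)
      (cong (_++ 1 ∷ []) (trans (trans (sym (map-∘ zs)) (map-∘ zs)) (cong (map suc) eq)))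
  , λ a∈ b∈ → agree′ (∈-++⁻ _ a∈) (∈-++⁻ _ b∈)
  where
  sucs : ℕ × ℕ → ℕ × ℕ
  sucs (x , y) = suc x , suc y
  pos : ∀ {a} → a ∈ zs → 1 ≤ proj₁ a × 1 ≤ proj₂ a
  pos a∈ = proj₁ (word-bounds σ (Sub.lookup s⊆ (∈-map⁺ proj₁ a∈)))
         , proj₁ (word-bounds π (subst (_ ∈_) eq (∈-map⁺ proj₂ a∈)))
  agree′ : ∀ {a b} → a ∈ map sucs zs ⊎ a ∈ (1 , 1) ∷ [] →
           b ∈ map sucs zs ⊎ b ∈ (1 , 1) ∷ [] → Agree a b
  agree′ (inj₁ a∈) (inj₁ b∈) with ∈-map⁻ _ a∈ | ∈-map⁻ _ b∈
  ... | a , a∈ , refl | b , b∈ , refl =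
    let (to , from) = agree a∈ b∈ in s≤s ∘ to ∘ s≤s⁻¹ , s≤s ∘ from ∘ s≤s⁻¹
  agree′ (inj₁ a∈) (inj₂ (here refl)) with ∈-map⁻ _ a∈
  ... | a , a∈ , refl = (λ { (s≤s ()) }) , (λ { (s≤s ()) })
  agree′ (inj₂ (here refl)) (inj₁ b∈) with ∈-map⁻ _ b∈
  ... | b , b∈ , refl = (λ _ → s≤s (proj₂ (pos b∈))) , (λ _ → s≤s (proj₁ (pos b∈)))
  agree′ (inj₂ (here refl)) (inj₂ (here refl)) = id , id

-- Inflations of identity permutations as block words

totalLength : List (ℕ × 𝔖) → ℕ
totalLength []             = 0
totalLength ((_ , σ) ∷ ps) = ∣ σ ∣ + totalLength ps

totalLength-∷ʳ : ∀ ps {t} σ → totalLength (ps ++ (t , σ) ∷ []) ≡ totalLength ps + ∣ σ ∣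
totalLength-∷ʳ []             σ = +-identityʳ ∣ σ ∣
totalLength-∷ʳ ((_ , ρ) ∷ ps) σ = trans (cong (∣ ρ ∣ +_) (totalLength-∷ʳ ps σ)) (sym (+-assoc ∣ ρ ∣ _ _))

offset-++ : ∀ {t} ps qs → All ((_< t) ∘ proj₁) ps → All ((t ≤_) ∘ proj₁) qs →
            offset (ps ++ qs) t ≡ totalLength ps
offset-++     []             []             []       []       = refl
offset-++ {t} []             ((u , _) ∷ qs) []       (t≤u ∷ ≥) with u <? t
... | yes u<t = contradiction u<t (≤⇒≯ t≤u)
... | no  _   = offset-++ [] qs [] ≥
offset-++ {t} ((u , σ) ∷ ps) qs             (u<t ∷ ps<) ≥       with u <? t
... | yes _   = cong (∣ σ ∣ +_) (offset-++ ps qs ps< ≥)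
... | no  u≮t = contradiction u<t u≮t

StrictlyIncreasing : (ℕ → ℕ) → Set
StrictlyIncreasing f = ∀ {i j} → i < j → f i < f j

zip-≥ : ∀ {t} f (σs : List 𝔖) n → (∀ i → t ≤ f i) → All ((t ≤_) ∘ proj₁) (zip (applyUpTo f n) σs)
zip-≥ f σs       zero    _ = []
zip-≥ f []       (suc n) _ = []
zip-≥ f (σ ∷ σs) (suc n) ≥ = ≥ 0 ∷ zip-≥ (f ∘ suc) σs n (≥ ∘ suc)

-- `offset` always consults the full list of pairs, so the induction carries along the pairs `ps`
-- already passed. The function `f` starts as `suc` and is composed with `suc` at each step,
-- following the recursion of `applyUpTo`.
concat-blocks : ∀ ps f πs → StrictlyIncreasing f → All ((_< f 0) ∘ proj₁) ps →
  let qs = zip (applyUpTo f (length πs)) (map _* πs) in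
  concat (map (block (ps ++ qs)) qs) ≡ blockWord (totalLength ps) πs
concat-blocks ps f []       inc <f = refl
concat-blocks ps f (π ∷ πs) inc <f = cong₂ _++_
  (cong (λ c → map (c +_) (word (π *)))
    (offset-++ ps (q ∷ qs) <f
      (≤-refl ∷ zip-≥ (f ∘ suc) (map _* πs) (length πs) (λ _ → <⇒≤ (inc (s≤s z≤n))))))
  (begin
    concat (map (block (ps ++ q ∷ qs)) qs)
      ≡⟨ cong (λ z → concat (map (block z) qs)) (sym (++-assoc ps (q ∷ []) qs)) ⟩
    concat (map (block ((ps ++ q ∷ []) ++ qs)) qs)
      ≡⟨ concat-blocks (ps ++ q ∷ []) (f ∘ suc) πs (inc ∘ s≤s)
           (All.++⁺ (All.map (λ u< → <-trans u< (inc (s≤s z≤n))) <f) (inc (s≤s z≤n) ∷ [])) ⟩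
    blockWord (totalLength (ps ++ q ∷ [])) πs
      ≡⟨ cong (λ c → blockWord c πs) (totalLength-∷ʳ ps (π *)) ⟩
    blockWord (totalLength ps + ∣ π * ∣) πs ∎)
  where
  open ≡-Reasoning
  q  = f 0 , π *
  qs = zip (applyUpTo (f ∘ suc) (length πs)) (map _* πs)

word-ι* : ∀ πs → word ι[ πs *] ≡ blockWord 0 πs
word-ι* πs = concat-blocks [] suc πs s≤s []

blockWord-take-⊆ : ∀ c πs {j i} → j ≤ i → blockWord c (take j πs) ⊆ blockWord c (take i πs)
blockWord-take-⊆ c πs       z≤n       = Sub.minimum _
blockWord-take-⊆ c []       (s≤s j≤i) = []
blockWord-take-⊆ c (π ∷ πs) (s≤s j≤i) = Sub.++⁺ ⊆-refl (blockWord-take-⊆ _ πs j≤i)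

blockWord-take-drop : ∀ c πs j →
  blockWord c πs ≡ blockWord c (take j πs) ++ blockWord (c + blockLength (take j πs)) (drop j πs)
blockWord-take-drop c πs j =
  trans (cong (blockWord c) (sym (take++drop≡id j πs))) (blockWord-++ c (take j πs) (drop j πs))

blockWord-drop-⊆ : ∀ c πs {j i} → j ≤ i →
                   ∃ λ e → blockWord e (drop i πs) ⊆ blockWord c (drop j πs)
blockWord-drop-⊆ c πs {i = i} z≤n = c + blockLength (take i πs)
  , subst (blockWord (c + blockLength (take i πs)) (drop i πs) ⊆_) (sym (blockWord-take-drop c πs i))
      (Sub.++⁺ˡ (blockWord c (take i πs)) ⊆-refl)
blockWord-drop-⊆ c []       (s≤s j≤i) = 0 , []
blockWord-drop-⊆ c (π ∷ πs) (s≤s j≤i) = blockWord-drop-⊆ c πs j≤i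

blockWord-drop-≼ : ∀ πs {j i w} → j ≤ i → blockWord 0 (drop j πs) ≼ w → blockWord 0 (drop i πs) ≼ w
blockWord-drop-≼ πs {i = i} j≤i occ with blockWord-drop-⊆ 0 πs j≤i
... | e , s⊆ = unshift-pattern e (subst (_≼ _) (blockWord-shift₀ e (drop i πs)) (⊆-≼ s⊆ occ))

blockWord-singleton : ∀ π → blockWord 0 (π ∷ []) ≡ word (π *)
blockWord-singleton π = trans (++-identityʳ _) (map-id (word (π *)))

-- With a second block present, the entry 1 that ends the first block is not the last entry of the
-- pattern. This is the shape that `≼-star⁻` asks for.
blockWord-two : ∀ π ρ πs → ∃₂ λ t ts →
  blockWord 0 (π ∷ ρ ∷ πs) ≡ map suc (word π) ++ 1 ∷ t ∷ ts
blockWord-two π ρ πs = _ , _ , trans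
  (cong₂ _++_ (map-id (word (π *))) (proj₂ (proj₂ (nonempty (word ρ)))))
  (++-assoc (map suc (word π)) (1 ∷ []) _)
  where
  nonempty : ∀ w {c ys} → ∃₂ λ t ts → map (c +_) (map suc w ++ 1 ∷ []) ++ ys ≡ t ∷ ts
  nonempty []      = _ , _ , refl
  nonempty (_ ∷ _) = _ , _ , refl

-- The origin of the exceptional value π̲(1) = π₁. A prefix of one block is π₁*, whose final 1 may
-- be matched with that of `σ *`, leaving π₁ in `σ`. A longer prefix has its 1 before its end,
-- cannot use the final 1 of `σ *`, and so occurs in `σ` as it stands.
≼-star⁻-lower : ∀ σ πs {i} → i < length πs →
                blockWord 0 (take (suc i) πs) ≼ word (σ *) → word (lower πs (suc i)) ≼ word σ
≼-star⁻-lower σ (π ∷ πs)     {zero}  i< occ =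
  star≼star⁻ π σ (subst (_≼ word (σ *)) (blockWord-singleton π) occ)
≼-star⁻-lower σ (π ∷ [])     {suc i} (s≤s ()) occ
≼-star⁻-lower σ (π ∷ ρ ∷ πs) {suc i} i< occ =
  subst (_≼ word σ) (sym (word-ι* (π ∷ ρ ∷ take i πs)))
    (≼-star⁻ σ (map suc (word π)) _ (proj₂ (proj₂ (blockWord-two π ρ (take i πs))))
      (proj₁ ∘ blockWord-bounds 0 (π ∷ ρ ∷ take i πs)) occ)

≼-star⁺-lower : ∀ σ πs {i} → i < length πs →
                word (lower πs (suc i)) ≼ word σ → blockWord 0 (take (suc i) πs) ≼ word (σ *)
≼-star⁺-lower σ (π ∷ πs) {zero}  i< occ =
  subst (_≼ word (σ *)) (sym (blockWord-singleton π)) (star≼star⁺ π σ occ)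
≼-star⁺-lower σ (π ∷ πs) {suc i} i< occ =
  ≼-⊆ (shift-text 1 (subst (_≼ word σ) (word-ι* (take (suc (suc i)) (π ∷ πs))) occ)) (⊆-star σ)

upper⇒≼ : ∀ σ πs i → σ contains upper πs (suc i) → blockWord 0 (drop i πs) ≼ word σ
upper⇒≼ σ πs i = subst (_≼ word σ) (word-ι* (drop i πs)) ∘ contains⇒≼ {σ} {upper πs (suc i)}

≼⇒upper : ∀ σ πs i → blockWord 0 (drop i πs) ≼ word σ → σ contains upper πs (suc i)
≼⇒upper σ πs i = ≼⇒contains {σ} {upper πs (suc i)} ∘ subst (_≼ word σ) (sym (word-ι* (drop i πs)))

-- Since `lower` treats its first value separately, the comparison is made in `σ *`: there each of
-- these patterns turns into a prefix of the block word, and prefixes are nested.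
lower-mono : ∀ σ πs {i j} → i ≤ j → j < length πs →
             σ contains lower πs (suc j) → σ contains lower πs (suc i)
lower-mono σ πs {i} {j} i≤j j< c =
  ≼⇒contains {σ} {lower πs (suc i)} (≼-star⁻-lower σ πs (≤-<-trans i≤j j<)
    (⊆-≼ (blockWord-take-⊆ 0 πs (s≤s i≤j))
      (≼-star⁺-lower σ πs j< (contains⇒≼ {σ} {lower πs (suc j)} c))))

upper-mono : ∀ σ πs {i j} → i ≤ j →
             σ contains upper πs (suc i) → σ contains upper πs (suc j)
upper-mono σ πs {i} {j} i≤j = ≼⇒upper σ πs j ∘ blockWord-drop-≼ πs i≤j ∘ upper⇒≼ σ πs i

-- Containment and avoidance in 213[σ₁,1,σ₂]

module _ (σ₁ σ₂ : 𝔖) where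

  contains-213-split : ∀ π → 213[ σ₁ ,1, σ₂ ] contains π →
    ∃₂ λ p₁ p₂ → word π ≡ p₁ ++ p₂ × p₁ ≼ word (σ₁ *) × p₂ ≼ word σ₂ × p₁ ≪ p₂
  contains-213-split π c = ≼-213⁻ σ₁ σ₂ (contains⇒≼ {213[ σ₁ ,1, σ₂ ]} {π} c)

  contains-213-join : ∀ π p₁ p₂ → word π ≡ p₁ ++ p₂ → p₁ ≪ p₂ →
    p₁ ≼ word (σ₁ *) → p₂ ≼ word σ₂ → 213[ σ₁ ,1, σ₂ ] contains π
  contains-213-join π p₁ p₂ eq p≪ o₁ o₂ = ≼⇒contains {213[ σ₁ ,1, σ₂ ]} {π}
    (subst (_≼ word 213[ σ₁ ,1, σ₂ ]) (sym eq) (≼-213⁺ σ₁ σ₂ p≪ o₁ o₂))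

module _ (σ₁ σ₂ π : 𝔖) (πs : List 𝔖) (word-π : word π ≡ blockWord 0 πs) where

  contains-213⁻ : 213[ σ₁ ,1, σ₂ ] contains π →
    ∃ λ j → blockWord 0 (take j πs) ≼ word (σ₁ *) × blockWord 0 (drop j πs) ≼ word σ₂
  contains-213⁻ c with contains-213-split σ₁ σ₂ π c
  ... | p₁ , p₂ , eq , o₁ , o₂ , p≪ with blockWord-cut 0 πs p₁ p₂ (trans (sym word-π) eq) p≪
  ...   | j , refl , refl = j , o₁ , unshift-pattern (blockLength (take j πs))
            (subst (_≼ word σ₂) (blockWord-shift₀ (blockLength (take j πs)) (drop j πs)) o₂)

  contains-213⁺ : ∀ j → blockWord 0 (take j πs) ≼ word (σ₁ *) → blockWord 0 (drop j πs) ≼ word σ₂ →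
    213[ σ₁ ,1, σ₂ ] contains π
  contains-213⁺ j o₁ o₂ = contains-213-join σ₁ σ₂ π _ _
    (trans word-π (blockWord-take-drop 0 πs j))
    (blockWord-≪ 0 (take j πs) (drop j πs)) o₁
    (subst (_≼ word σ₂) (sym (blockWord-shift₀ (blockLength (take j πs)) (drop j πs)))
      (shift-pattern (blockLength (take j πs)) o₂))

  SplitAvoidance : Set
  SplitAvoidance = ∃ λ i → i < length πs × σ₁ avoids lower πs (suc i) × σ₂ avoids upper πs (suc i)

  -- Counted from 0, block i lies to the right of a cut after j blocks if j ≤ i, and to the left of
  -- it otherwise. In the first case all blocks from i on occur in `σ₂`; in the second all blocks up
  -- to and including i occur in `σ₁ *`.
  avoids-213⁺ : SplitAvoidance → 213[ σ₁ ,1, σ₂ ] avoids π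
  avoids-213⁺ (i , i< , av₁ , av₂) c with contains-213⁻ c
  ... | j , o₁ , o₂ with j ≤? i
  ...   | yes j≤i = av₂ (≼⇒upper σ₂ πs i (blockWord-drop-≼ πs j≤i o₂))
  ...   | no  j≰i = av₁ (≼⇒contains {σ₁} {lower πs (suc i)}
            (≼-star⁻-lower σ₁ πs i< (⊆-≼ (blockWord-take-⊆ 0 πs (≰⇒> j≰i)) o₁)))

  -- Looks for the least i with `σ₁` avoiding `lower πs (suc i)`, while keeping `σ₂` free of
  -- `upper πs (suc i)`. The cut before all blocks starts this off; each failure on the left,
  -- combined with the next cut, carries it one step further. The search cannot reach i = r, where
  -- the remaining suffix is empty and hence contained in `σ₂`.
  avoids-213⁻ : 213[ σ₁ ,1, σ₂ ] avoids π → SplitAvoidance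
  avoids-213⁻ av = search (length πs) 0 refl (av ∘ contains-213⁺ 0 []≼ ∘ upper⇒≼ σ₂ πs 0)
    where
    search : ∀ k i → i + k ≡ length πs → σ₂ avoids upper πs (suc i) → SplitAvoidance
    search zero    i eq av₂ = contradiction
      (≼⇒upper σ₂ πs i (subst (λ z → blockWord 0 z ≼ word σ₂)
        (sym (drop-all i πs (≤-reflexive (trans (sym eq) (+-identityʳ i))))) []≼)) av₂
    search (suc k) i eq av₂ with contains? σ₁ (lower πs (suc i))
    ... | no  av₁ = i , i< , av₁ , av₂
      where
      i< : i < length πs
      i< = subst (i <_) eq (m<m+n i (s≤s z≤n))
    ... | yes c₁  = search k (suc i) (trans (sym (+-suc i k)) eq) λ c₂ →
      av (contains-213⁺ (suc i)
        (≼-star⁺-lower σ₁ πs (subst (i <_) eq (m<m+n i (s≤s z≤n))) (contains⇒≼ {σ₁} {lower πs (suc i)} c₁))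
        (upper⇒≼ σ₂ πs (suc i) c₂))

module _ (σ₁ σ₂ : 𝔖) where

  -- 312 has no proper prefix lying below the rest, so an occurrence cannot run across the seam. Its
  -- 1 is not at its end, so an occurrence in `σ₁ *` cannot use the final 1.
  avoids312-213⁺ : σ₁ avoids p312 → σ₂ avoids p312 → 213[ σ₁ ,1, σ₂ ] avoids p312
  avoids312-213⁺ av₁ av₂ c with contains-213-split σ₁ σ₂ p312 c
  ... | [] , _ , refl , _ , o₂ , _ = av₂ (≼⇒contains {σ₂} {p312} o₂)
  ... | 3 ∷ [] , _ , refl , _ , _ , p≪ = contradiction (p≪ (here refl) (here refl)) λ { (s≤s ()) }
  ... | 3 ∷ 1 ∷ [] , _ , refl , _ , _ , p≪ = contradiction (p≪ (here refl) (here refl)) λ { (s≤s (s≤s ())) }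
  ... | 3 ∷ 1 ∷ 2 ∷ [] , [] , refl , o₁ , _ , _ = av₁ (≼⇒contains {σ₁} {p312}
          (≼-star⁻ σ₁ (3 ∷ []) 2 refl (proj₁ ∘ word-bounds p312) o₁))
  ... | _ ∷ _ ∷ _ ∷ _ ∷ _ , _ , () , _

  avoids312-213⁻ : 213[ σ₁ ,1, σ₂ ] avoids p312 → σ₁ avoids p312 × σ₂ avoids p312
  avoids312-213⁻ av =
      (λ c → av (contains-213-join σ₁ σ₂ p312 (word p312) [] refl (λ _ ())
               (≼-⊆ (shift-text 1 (contains⇒≼ {σ₁} {p312} c)) (⊆-star σ₁)) []≼))
    , (λ c → av (contains-213-join σ₁ σ₂ p312 [] (word p312) refl (λ ())
               []≼ (contains⇒≼ {σ₂} {p312} c)))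

-- The decomposition of 312-avoiding permutations

lookup-injective : ∀ {A : Set} {xs : List A} → Unique xs → ∀ i j → lookup xs i ≡ lookup xs j → i ≡ j
lookup-injective (_  ∷ _) zero    zero    _  = refl
lookup-injective (x≢ ∷ _) zero    (suc j) eq = contradiction eq (All.lookup x≢ (∈-lookup j))
lookup-injective (x≢ ∷ _) (suc i) zero    eq = contradiction (sym eq) (All.lookup x≢ (∈-lookup i))
lookup-injective (_  ∷ u) (suc i) (suc j) eq = cong suc (lookup-injective u i j eq)

-- The pigeonhole principle: the entry at each position, lowered by `suc a`, injects the positions
-- into `Fin (b ∸ a)`.
unique-in-interval : ∀ a b xs → Unique xs → (∀ {x} → x ∈ xs → a < x × x ≤ b) → length xs ≤ b ∸ a
unique-in-interval a b xs u bd = injective⇒≤ {f = index} λ {i} {j} eq →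
  lookup-injective u i j (∸-cancelʳ-≡ (proj₁ (bd (∈-lookup i))) (proj₁ (bd (∈-lookup j)))
    (fromℕ<-injective _ _ (in-range i) (in-range j) eq))
  where
  in-range : ∀ i → lookup xs i ∸ suc a < b ∸ a
  in-range i = let (a< , ≤b) = bd (∈-lookup i) in
    subst (_≤ b ∸ a) (sym (m<n⇒n∸m≡1+[n∸1+m] a<)) (∸-monoˡ-≤ a ≤b)
    where
    m<n⇒n∸m≡1+[n∸1+m] : ∀ {m n} → m < n → suc (n ∸ suc m) ≡ n ∸ m
    m<n⇒n∸m≡1+[n∸1+m] m<n = sym (+-∸-assoc 1 m<n)
  index : Fin (length xs) → Fin (b ∸ a)
  index i = fromℕ< (in-range i)

unique-++⁻ : ∀ {A : Set} (u : List A) {v} → Unique (u ++ v) →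
             Unique u × Unique v × (∀ {x y} → x ∈ u → y ∈ v → x ≢ y)
unique-++⁻ []      uv        = [] , uv , λ ()
unique-++⁻ (x ∷ u) (x≢ ∷ uv) with unique-++⁻ u uv
... | uu , uv′ , ne = All.++⁻ˡ u x≢ ∷ uu , uv′ , λ
  { (here refl) y∈ → All.lookup (All.++⁻ʳ u x≢) y∈
  ; (there x∈)  y∈ → ne x∈ y∈ }

word-injective : ∀ {σ τ} → word σ ≡ word τ → σ ≡ τ
word-injective {perm _ _} {perm _ _} refl = refl

occurrence-312 : ∀ {u v x y} → x ∈ u → y ∈ v → 1 < y → y < x → 3 ∷ 1 ∷ 2 ∷ [] ≼ u ++ 1 ∷ v
occurrence-312 {x = x} {y} x∈ y∈ 1<y y<x =
    zs , Sub.++⁺ (Sub.from∈ x∈) (refl ∷ Sub.from∈ y∈) , refl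
  , λ a∈ b∈ → agree a∈ b∈
  where
  zs : List (ℕ × ℕ)
  zs = (x , 3) ∷ (1 , 1) ∷ (y , 2) ∷ []
  1<x : 1 < x
  1<x = <-trans 1<y y<x
  same : ∀ a → Agree a a
  same a = (λ lt → contradiction lt (<-irrefl refl)) , (λ lt → contradiction lt (<-irrefl refl))
  less : ∀ {a b} → proj₁ a < proj₁ b → proj₂ a < proj₂ b → Agree a b × Agree b a
  less p q = ((λ _ → q) , (λ _ → p)) , ((λ r → contradiction r (<⇒≯ p)) , (λ r → contradiction r (<⇒≯ q)))
  agree : ∀ {a b} → a ∈ zs → b ∈ zs → Agree a b
  agree (here refl)                 (here refl)                 = same (x , 3)
  agree (here refl)                 (there (here refl))         = proj₂ (less {1 , 1} {x , 3} 1<x (s≤s (s≤s z≤n)))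
  agree (here refl)                 (there (there (here refl))) = proj₂ (less {y , 2} {x , 3} y<x ≤-refl)
  agree (there (here refl))         (here refl)                 = proj₁ (less {1 , 1} {x , 3} 1<x (s≤s (s≤s z≤n)))
  agree (there (here refl))         (there (here refl))         = same (1 , 1)
  agree (there (here refl))         (there (there (here refl))) = proj₁ (less {1 , 1} {y , 2} 1<y ≤-refl)
  agree (there (there (here refl))) (here refl)                 = proj₁ (less {y , 2} {x , 3} y<x ≤-refl)
  agree (there (there (here refl))) (there (here refl))         = proj₂ (less {1 , 1} {y , 2} 1<y ≤-refl)
  agree (there (there (here refl))) (there (there (here refl))) = same (y , 2)

-- Without the value 1, `suc n` distinct entries would have to fit among the `n` numbers from 2 to
-- `suc n`.
1∈permutation : ∀ w n → length w ≡ suc n → IsPermutation w → 1 ∈ w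
1∈permutation w n len (uw , bd) with DecMembership._∈?_ _≟_ 1 w
... | yes 1∈ = 1∈
... | no  1∉ = contradiction
  (unique-in-interval 1 (suc n) w uw λ {x} x∈ → let (1≤ , ≤l) = All.lookup bd x∈ in
    ≤∧≢⇒< 1≤ (λ { refl → 1∉ x∈ }) , subst (x ≤_) len ≤l)
  (<⇒≱ (≤-reflexive (sym len)))

map-unmap : ∀ {f g : ℕ → ℕ} w → All (λ x → f (g x) ≡ x) w → map f (map g w) ≡ w
map-unmap w fg = trans (sym (map-∘ w)) (map-id-local fg)

-- Write the word as u 1 v.  Avoidance of 312 gives u < v entrywise, and
-- counting the distinct values below v and above u pins both value ranges.
module _ {u v : List ℕ} (isPerm : IsPermutation (u ++ 1 ∷ v))
         (avoids312 : ¬ (3 ∷ 1 ∷ 2 ∷ [] ≼ u ++ 1 ∷ v)) where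
  private
    k = length u
    N = length (u ++ 1 ∷ v)

    N≡ : N ≡ k + suc (length v)
    N≡ = length-++ u

    unique-u : Unique u
    unique-u = proj₁ (unique-++⁻ u (proj₁ isPerm))

    unique-1v : Unique (1 ∷ v)
    unique-1v = proj₁ (proj₂ (unique-++⁻ u (proj₁ isPerm)))

    unique-v : Unique v
    unique-v with unique-1v
    ... | _ ∷ uv = uv

    u≢1v : ∀ {x y} → x ∈ u → y ∈ 1 ∷ v → x ≢ y
    u≢1v = proj₂ (proj₂ (unique-++⁻ u (proj₁ isPerm)))

    bounds : ∀ {x} → x ∈ u ++ 1 ∷ v → 1 ≤ x × x ≤ N
    bounds = All.lookup (proj₂ isPerm)

    1<u : ∀ {x} → x ∈ u → 1 < x
    1<u x∈ = ≤∧≢⇒< (proj₁ (bounds (∈-++⁺ˡ x∈))) (u≢1v x∈ (here refl) ∘ sym)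

    1<v : ∀ {y} → y ∈ v → 1 < y
    1<v y∈ with unique-1v
    ... | 1≢ ∷ _ = ≤∧≢⇒< (proj₁ (bounds (∈-++⁺ʳ u (there y∈)))) (All.lookup 1≢ y∈)

    u<v : u ≪ v
    u<v {x} {y} x∈ y∈ with <-cmp x y
    ... | tri< x<y _ _ = x<y
    ... | tri≈ _ x≡y _ = contradiction x≡y (u≢1v x∈ (there y∈))
    ... | tri> _ _ y<x = contradiction (occurrence-312 x∈ y∈ (1<v y∈) y<x) avoids312

    u≤ : ∀ {x} → x ∈ u → x ≤ k + 1
    u≤ {x} x∈ = +-cancelʳ-≤ (length v) x (k + 1) (begin
      x + length v     ≤⟨ +-monoʳ-≤ x (unique-in-interval x N v unique-v
                            λ y∈ → u<v x∈ y∈ , proj₂ (bounds (∈-++⁺ʳ u (there y∈)))) ⟩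
      x + (N ∸ x)      ≡⟨ m+[n∸m]≡n (proj₂ (bounds (∈-++⁺ˡ x∈))) ⟩
      N                ≡⟨ N≡ ⟩
      k + suc (length v) ≡⟨ +-assoc k 1 (length v) ⟨
      k + 1 + length v ∎)
      where open ≤-Reasoning

    <v : ∀ {y} → y ∈ v → k + 1 < y
    <v {zero}  y∈ = contradiction (1<v y∈) λ ()
    <v {suc y} y∈ = s≤s (begin
      k + 1       ≤⟨ +-monoˡ-≤ 1 (unique-in-interval 1 y u unique-u
                       λ x∈ → 1<u x∈ , s≤s⁻¹ (u<v x∈ y∈)) ⟩
      y ∸ 1 + 1   ≡⟨ m∸n+n≡m (s≤s⁻¹ (1<v y∈)) ⟩
      y           ∎)
      where open ≤-Reasoning

    u₀ v₀ : List ℕ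
    u₀ = map pred u
    v₀ = map (_∸ (k + 1)) v

    suc-u₀ : map suc u₀ ≡ u
    suc-u₀ = map-unmap u (All.tabulate λ x∈ → suc-pred′ (1<u x∈))
      where
      suc-pred′ : ∀ {x} → 1 < x → suc (pred x) ≡ x
      suc-pred′ (s≤s _) = refl

    shift-v₀ : map ((k + 1) +_) v₀ ≡ v
    shift-v₀ = map-unmap v (All.tabulate λ y∈ → m+[n∸m]≡n (<⇒≤ (<v y∈)))

    unmap-unique : ∀ {f : ℕ → ℕ} {w₀ w} → map f w₀ ≡ w → Unique w → Unique w₀
    unmap-unique refl uw = Unique.map⁻ uw

    perm-u₀ : IsPermutation u₀
    perm-u₀ = unmap-unique suc-u₀ unique-u , All.map⁺ (All.tabulate λ {x} x∈ →
        pred-mono-≤ (1<u x∈)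
      , subst (pred x ≤_) (sym (length-map pred u)) (subst (pred x ≤_) (m+n∸n≡m k 1) (∸-monoˡ-≤ 1 (u≤ x∈))))

    perm-v₀ : IsPermutation v₀
    perm-v₀ = unmap-unique shift-v₀ unique-v , All.map⁺ (All.tabulate λ {y} y∈ →
        m<n⇒0<n∸m (<v y∈)
      , (begin
          y ∸ (k + 1)                    ≤⟨ ∸-monoˡ-≤ (k + 1) (proj₂ (bounds (∈-++⁺ʳ u (there y∈)))) ⟩
          N ∸ (k + 1)                    ≡⟨ cong (_∸ (k + 1)) (trans N≡ (sym (+-assoc k 1 (length v)))) ⟩
          k + 1 + length v ∸ (k + 1)     ≡⟨ m+n∸m≡n (k + 1) (length v) ⟩
          length v                       ≡⟨ length-map (_∸ (k + 1)) v ⟨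
          length v₀                      ∎))
      where open ≤-Reasoning

  decompose-word : ∃₂ λ σ₁ σ₂ → u ++ 1 ∷ v ≡ word 213[ σ₁ ,1, σ₂ ]
  decompose-word = σ₁ , perm v₀ perm-v₀ , sym (trans (word-213 σ₁ (perm v₀ perm-v₀)) (begin
    (map suc u₀ ++ 1 ∷ []) ++ map ((length u₀ + 1) +_) v₀
      ≡⟨ ++-assoc (map suc u₀) (1 ∷ []) _ ⟩
    map suc u₀ ++ 1 ∷ map ((length u₀ + 1) +_) v₀
      ≡⟨ cong₂ (λ a b → a ++ 1 ∷ b) suc-u₀
           (trans (cong (λ l → map ((l + 1) +_) v₀) (length-map pred u)) shift-v₀) ⟩
    u ++ 1 ∷ v ∎))
    where
    open ≡-Reasoning
    σ₁ : 𝔖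
    σ₁ = perm u₀ perm-u₀

decompose : ∀ σ n → ∣ σ ∣ ≡ suc n → σ avoids p312 → ∃₂ λ σ₁ σ₂ → σ ≡ 213[ σ₁ ,1, σ₂ ]
decompose σ n len av with ∈-∃++ (1∈permutation (word σ) n len (valid σ))
... | u , v , eq with decompose-word {u} {v} (subst IsPermutation eq (valid σ))
                       (av ∘ ≼⇒contains {σ} {p312} ∘ subst (_ ≼_) (sym eq))
...   | σ₁ , σ₂ , eq′ = σ₁ , σ₂ , word-injective (trans eq eq′)

length-213 : ∀ σ₁ σ₂ → ∣ 213[ σ₁ ,1, σ₂ ] ∣ ≡ suc (∣ σ₁ ∣ + ∣ σ₂ ∣)
length-213 σ₁ σ₂ = begin
  ∣ 213[ σ₁ ,1, σ₂ ] ∣   ≡⟨ cong length (word-213 σ₁ σ₂) ⟩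
  length (word (σ₁ *) ++ map ((∣ σ₁ ∣ + 1) +_) (word σ₂))
    ≡⟨ length-++ (word (σ₁ *)) ⟩
  ∣ σ₁ * ∣ + length (map ((∣ σ₁ ∣ + 1) +_) (word σ₂))
    ≡⟨ cong₂ _+_ (trans (length-star σ₁) (+-comm ∣ σ₁ ∣ 1)) (length-map _ (word σ₂)) ⟩
  suc (∣ σ₁ ∣ + ∣ σ₂ ∣) ∎
  where open ≡-Reasoning

-- The entry 1 of 213[σ₁,1,σ₂] marks where σ₁ ends.
++1-injective : ∀ u u′ {v v′} → All (1 ≤_) u → All (1 ≤_) u′ →
  map suc u ++ 1 ∷ v ≡ map suc u′ ++ 1 ∷ v′ → u ≡ u′ × v ≡ v′
++1-injective []      []       []        []         refl = refl , refl
++1-injective []      (_ ∷ _)  []        (s≤s _ ∷ _) ()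
++1-injective (_ ∷ _) []       (s≤s _ ∷ _) []        ()
++1-injective (x ∷ u) (x′ ∷ u′) (_ ∷ p)  (_ ∷ p′)   eq with ∷-injective eq
... | refl , eq′ with ++1-injective u u′ p p′ eq′
...   | refl , eq″ = refl , eq″

213-injective : ∀ {σ₁ σ₂ τ₁ τ₂} → 213[ σ₁ ,1, σ₂ ] ≡ 213[ τ₁ ,1, τ₂ ] → σ₁ ≡ τ₁ × σ₂ ≡ τ₂
213-injective {σ₁} {σ₂} {τ₁} {τ₂} eq = σ₁≡τ₁ , word-injective (map-injective (+-cancelˡ-≡ (∣ σ₁ ∣ + 1) _ _)
  (trans (proj₂ parts) (cong (λ τ → map ((∣ τ ∣ + 1) +_) (word τ₂)) (sym σ₁≡τ₁))))
  where
  positive : ∀ σ → All (1 ≤_) (word σ)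
  positive σ = All.map proj₁ (proj₂ (valid σ))
  word-213′ : ∀ σ₁ σ₂ → word 213[ σ₁ ,1, σ₂ ] ≡ map suc (word σ₁) ++ 1 ∷ map ((∣ σ₁ ∣ + 1) +_) (word σ₂)
  word-213′ σ₁ σ₂ = trans (word-213 σ₁ σ₂) (++-assoc (map suc (word σ₁)) (1 ∷ []) _)
  parts : word σ₁ ≡ word τ₁ × map ((∣ σ₁ ∣ + 1) +_) (word σ₂) ≡ map ((∣ τ₁ ∣ + 1) +_) (word τ₂)
  parts = ++1-injective (word σ₁) (word τ₁) (positive σ₁) (positive τ₁)
    (trans (sym (word-213′ σ₁ σ₂)) (trans (cong word eq) (word-213′ τ₁ τ₂)))
  σ₁≡τ₁ : σ₁ ≡ τ₁
  σ₁≡τ₁ = word-injective (proj₁ parts)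

-- Enumeration of permutations and of the pairs (σ₁, σ₂)

words-unique : ∀ l {as} → Unique as → Unique (words l as)
words-unique zero    uas = [] ∷ []
words-unique (suc l) uas = Unique.cartesianProductWith⁺ _∷_ ∷-injective uas (words-unique l uas)

∈-words⁺ : ∀ {as} w → All (_∈ as) w → w ∈ words (length w) as
∈-words⁺ []      []       = here refl
∈-words⁺ (x ∷ w) (x∈ ∷ p) = ∈-cartesianProductWith⁺ _∷_ x∈ (∈-words⁺ w p)

∈-words⁻ : ∀ l {as w} → w ∈ words l as → length w ≡ l
∈-words⁻ zero         (here refl) = refl
∈-words⁻ (suc l) {as} w∈ with ∈-cartesianProductWith⁻ _∷_ as (words l as) w∈
... | _ , _ , _ , w′∈ , refl = cong suc (∈-words⁻ l w′∈)

-- The selection made in `𝔖[_]`, for an arbitrary list of words so that induction on that list is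
-- possible. By definition `𝔖[ n ]` is the instance `words n [1… n ]`.
permutations : List (List ℕ) → List 𝔖
permutations = mapMaybe (λ w → Maybe.map (λ v → perm w v) (dec⇒maybe (isPermutation? w)))

∈-permutations⁻ : ∀ ws {σ} → σ ∈ permutations ws → word σ ∈ ws
∈-permutations⁻ (w ∷ ws) σ∈ with isPermutation? w | σ∈
... | yes _ | here refl = here refl
... | yes _ | there σ∈′ = there (∈-permutations⁻ ws σ∈′)
... | no  _ | σ∈′       = there (∈-permutations⁻ ws σ∈′)

∈-permutations⁺ : ∀ {ws} σ → word σ ∈ ws → σ ∈ permutations ws
∈-permutations⁺ {w ∷ ws} σ w∈ with isPermutation? w | w∈
... | yes _ | here refl = here refl
... | no ¬p | here refl = contradiction (valid σ) ¬p
... | yes _ | there w∈′ = there (∈-permutations⁺ σ w∈′)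
... | no  _ | there w∈′ = ∈-permutations⁺ σ w∈′

permutations-unique : ∀ {ws} → Unique ws → Unique (permutations ws)
permutations-unique []                = []
permutations-unique {w ∷ ws} (w≢ ∷ u) with isPermutation? w
... | yes _ = All.tabulate (λ σ∈ eq → All.lookup w≢ (∈-permutations⁻ ws σ∈) (cong word eq))
              ∷ permutations-unique u
... | no  _ = permutations-unique u

𝔖-unique : ∀ n → Unique 𝔖[ n ]
𝔖-unique n = permutations-unique (words-unique n
  (Unique.applyUpTo⁺₁ suc n λ i<j _ → <⇒≢ (s≤s i<j)))

∈-𝔖⁻ : ∀ n {σ} → σ ∈ 𝔖[ n ] → ∣ σ ∣ ≡ n
∈-𝔖⁻ n σ∈ = ∈-words⁻ n (∈-permutations⁻ (words n [1… n ]) σ∈)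

∈-𝔖⁺ : ∀ σ → σ ∈ 𝔖[ ∣ σ ∣ ]
∈-𝔖⁺ σ = ∈-permutations⁺ σ (∈-words⁺ (word σ) (All.map (λ (1≤ , ≤l) → ∈[1…] 1≤ ≤l) (proj₂ (valid σ))))
  where
  ∈[1…] : ∀ {x n} → 1 ≤ x → x ≤ n → x ∈ [1… n ]
  ∈[1…] (s≤s _) x≤n = ∈-applyUpTo⁺ suc x≤n

𝔖₃₁₂[_] : ℕ → List 𝔖
𝔖₃₁₂[ n ] = filter (avoidsAll? (p312 ∷ [])) 𝔖[ n ]

∈-𝔖₃₁₂⁻ : ∀ n {σ} → σ ∈ 𝔖₃₁₂[ n ] → σ ∈𝔖 n ⟨ p312 ∷ [] ⟩
∈-𝔖₃₁₂⁻ n σ∈ = let (σ∈𝔖 , av) = ∈-filter⁻ (avoidsAll? (p312 ∷ [])) {xs = 𝔖[ n ]} σ∈ in ∈-𝔖⁻ n σ∈𝔖 , av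

∈-𝔖₃₁₂⁺ : ∀ {n σ} → σ ∈𝔖 n ⟨ p312 ∷ [] ⟩ → σ ∈ 𝔖₃₁₂[ n ]
∈-𝔖₃₁₂⁺ {σ = σ} (refl , av) = ∈-filter⁺ (avoidsAll? (p312 ∷ [])) (∈-𝔖⁺ σ) av

𝔖₃₁₂-unique : ∀ n → Unique 𝔖₃₁₂[ n ]
𝔖₃₁₂-unique n = Unique.filter⁺ (avoidsAll? (p312 ∷ [])) (𝔖-unique n)

-- `g` reads off from an element the list it came from, so different lists are disjoint. For
-- `allPairs` it is the length of σ₁.
concatMap-unique : ∀ {A B : Set} (f : A → List B) (g : B → A) {ks} →
  (∀ k → Unique (f k)) → (∀ k {p} → p ∈ f k → g p ≡ k) →
  Unique ks → Unique (concatMap f ks)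
concatMap-unique f g {ks} uf gf uks = Unique.concat⁺
  (All.map⁺ (All.tabulate λ {k} _ → uf k))
  (AllPairs.map⁺ (AllPairs.map disjoint uks))
  where
  disjoint : ∀ {k l} → k ≢ l → Disjoint (f k) (f l)
  disjoint {k} {l} k≢l (p∈ , p∈′) = k≢l (trans (sym (gf k p∈)) (gf l p∈′))

-- Duplicate-free lists with the same members are rearrangements of each other, so a sum can be
-- reindexed along an injection from knowledge of membership alone.
↭-map : ∀ {A B : Set} (g : B → A) {xs ys} → (∀ {y y′} → g y ≡ g y′ → y ≡ y′) →
  Unique xs → Unique ys → (∀ {x} → x ∈ xs → ∃ λ y → y ∈ ys × x ≡ g y) →
  (∀ {y} → y ∈ ys → g y ∈ xs) → xs ↭ map g ys
↭-map g {xs} {ys} g-inj uxs uys to from =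
  ∼bag⇒↭ (unique∧set⇒bag uxs (Unique.map⁺ g-inj uys) (mk⇔ to′ from′))
  where
  to′ : ∀ {x} → x ∈ xs → x ∈ map g ys
  to′ x∈ with to x∈
  ... | y , y∈ , refl = ∈-map⁺ g y∈
  from′ : ∀ {x} → x ∈ map g ys → x ∈ xs
  from′ x∈ with ∈-map⁻ g x∈
  ... | y , y∈ , refl = from y∈

splitPairs : ℕ → ℕ → List (𝔖 × 𝔖)
splitPairs n k = cartesianProduct 𝔖₃₁₂[ k ] 𝔖₃₁₂[ n ∸ k ]

allPairs : ℕ → List (𝔖 × 𝔖)
allPairs n = concatMap (splitPairs n) (upTo (suc n))

∈-splitPairs⁻ : ∀ n k {p} → p ∈ splitPairs n k →
  proj₁ p ∈𝔖 k ⟨ p312 ∷ [] ⟩ × proj₂ p ∈𝔖 (n ∸ k) ⟨ p312 ∷ [] ⟩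
∈-splitPairs⁻ n k p∈ = let (σ₁∈ , σ₂∈) = ∈-cartesianProduct⁻ 𝔖₃₁₂[ k ] 𝔖₃₁₂[ n ∸ k ] p∈ in
  ∈-𝔖₃₁₂⁻ k σ₁∈ , ∈-𝔖₃₁₂⁻ (n ∸ k) σ₂∈

∈-allPairs⁻ : ∀ n {p} → p ∈ allPairs n → ∃ λ k → k ≤ n × p ∈ splitPairs n k
∈-allPairs⁻ n p∈ with ∈-concat⁻′ (map (splitPairs n) (upTo (suc n))) p∈
... | _ , p∈′ , l∈ with ∈-map⁻ (splitPairs n) l∈
...   | k , k∈ , refl = k , s≤s⁻¹ (∈-upTo⁻ k∈) , p∈′

∈-allPairs⁺ : ∀ n k {p} → k ≤ n → p ∈ splitPairs n k → p ∈ allPairs n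
∈-allPairs⁺ n k k≤n p∈ = ∈-concat⁺′ p∈ (∈-map⁺ (splitPairs n) (∈-upTo⁺ (s≤s k≤n)))

allPairs-unique : ∀ n → Unique (allPairs n)
allPairs-unique n = concatMap-unique (splitPairs n) (∣_∣ ∘ proj₁)
  (λ k → Unique.cartesianProduct⁺ (𝔖₃₁₂-unique k) (𝔖₃₁₂-unique (n ∸ k)))
  (λ k p∈ → proj₁ (proj₁ (∈-splitPairs⁻ n k p∈)))
  (Unique.upTo⁺ (suc n))

join : 𝔖 × 𝔖 → 𝔖
join (σ₁ , σ₂) = 213[ σ₁ ,1, σ₂ ]

join-injective : ∀ {p q} → join p ≡ join q → p ≡ q
join-injective {σ₁ , σ₂} {τ₁ , τ₂} eq with 213-injective {σ₁} {σ₂} {τ₁} {τ₂} eq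
... | e₁ , e₂ = cong₂ _,_ e₁ e₂

pair-∈ : ∀ n σ₁ σ₂ → 213[ σ₁ ,1, σ₂ ] ∈𝔖 suc n ⟨ p312 ∷ [] ⟩ → (σ₁ , σ₂) ∈ allPairs n
pair-∈ n σ₁ σ₂ (len , av) = ∈-allPairs⁺ n ∣ σ₁ ∣ (subst (∣ σ₁ ∣ ≤_) len′ (m≤m+n ∣ σ₁ ∣ ∣ σ₂ ∣))
  (∈-cartesianProduct⁺
    (∈-𝔖₃₁₂⁺ (refl , proj₁ avs ∷ []))
    (∈-𝔖₃₁₂⁺ (trans (sym (m+n∸m≡n ∣ σ₁ ∣ ∣ σ₂ ∣)) (cong (_∸ ∣ σ₁ ∣) len′) , proj₂ avs ∷ [])))
  where
  len′ : ∣ σ₁ ∣ + ∣ σ₂ ∣ ≡ n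
  len′ = suc-injective (trans (sym (length-213 σ₁ σ₂)) len)
  avs : σ₁ avoids p312 × σ₂ avoids p312
  avs = avoids312-213⁻ σ₁ σ₂ (All.head av)

split-∈ : ∀ n σ → σ ∈𝔖 suc n ⟨ p312 ∷ [] ⟩ → ∃ λ p → p ∈ allPairs n × σ ≡ join p
split-∈ n σ σ∈ =
  let (σ₁ , σ₂ , eq) = decompose σ n (proj₁ σ∈) (All.head (proj₂ σ∈)) in
  (σ₁ , σ₂) , pair-∈ n σ₁ σ₂ (subst (_∈𝔖 suc n ⟨ p312 ∷ [] ⟩) eq σ∈) , eq

join-∈ : ∀ n p → p ∈ allPairs n → join p ∈𝔖 suc n ⟨ p312 ∷ [] ⟩
join-∈ n (σ₁ , σ₂) p∈ =
  let (k , k≤n , p∈k) = ∈-allPairs⁻ n p∈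
      ((len₁ , av₁) , (len₂ , av₂)) = ∈-splitPairs⁻ n k p∈k
  in trans (length-213 σ₁ σ₂) (cong suc (trans (cong₂ _+_ len₁ len₂) (m+[n∸m]≡n k≤n)))
   , avoids312-213⁺ σ₁ σ₂ (All.head av₁) (All.head av₂) ∷ []

𝔖₃₁₂-decomposition : ∀ n → 𝔖₃₁₂[ suc n ] ↭ map join (allPairs n)
𝔖₃₁₂-decomposition n = ↭-map join (λ {p} {q} → join-injective {p} {q})
  (𝔖₃₁₂-unique (suc n)) (allPairs-unique n)
  (λ {σ} σ∈ → split-∈ n σ (∈-𝔖₃₁₂⁻ (suc n) σ∈))
  (λ {p} p∈ → ∈-𝔖₃₁₂⁺ (join-∈ n p p∈))

-- Sums of integers

+ᶻ-interchange : ∀ a b c d → (a +ᶻ b) +ᶻ (c +ᶻ d) ≡ (a +ᶻ c) +ᶻ (b +ᶻ d)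
+ᶻ-interchange = solve-∀

∑ᶻ : {A : Set} → List A → (A → ℤ) → ℤ
∑ᶻ []       t = 0ℤ
∑ᶻ (x ∷ xs) t = t x +ᶻ ∑ᶻ xs t

module _ {A : Set} where

  ∑ᶻ-cong-∈ : ∀ xs {t u : A → ℤ} → (∀ {x} → x ∈ xs → t x ≡ u x) → ∑ᶻ xs t ≡ ∑ᶻ xs u
  ∑ᶻ-cong-∈ []       _  = refl
  ∑ᶻ-cong-∈ (x ∷ xs) eq = cong₂ _+ᶻ_ (eq (here refl)) (∑ᶻ-cong-∈ xs (eq ∘ there))

  ∑ᶻ-cong : ∀ xs {t u : A → ℤ} → (∀ x → t x ≡ u x) → ∑ᶻ xs t ≡ ∑ᶻ xs u
  ∑ᶻ-cong xs eq = ∑ᶻ-cong-∈ xs λ {x} _ → eq x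

  ∑ᶻ-++ : ∀ xs {ys} (t : A → ℤ) → ∑ᶻ (xs ++ ys) t ≡ ∑ᶻ xs t +ᶻ ∑ᶻ ys t
  ∑ᶻ-++ []       t = sym (ℤ.+-identityˡ _)
  ∑ᶻ-++ (x ∷ xs) t = trans (cong (t x +ᶻ_) (∑ᶻ-++ xs t)) (sym (ℤ.+-assoc (t x) _ _))

  ∑ᶻ-0 : ∀ (xs : List A) → ∑ᶻ xs (λ _ → 0ℤ) ≡ 0ℤ
  ∑ᶻ-0 []       = refl
  ∑ᶻ-0 (x ∷ xs) = trans (ℤ.+-identityˡ _) (∑ᶻ-0 xs)

  ∑ᶻ-+ : ∀ xs (t u : A → ℤ) → ∑ᶻ xs (λ x → t x +ᶻ u x) ≡ ∑ᶻ xs t +ᶻ ∑ᶻ xs u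
  ∑ᶻ-+ []       t u = refl
  ∑ᶻ-+ (x ∷ xs) t u = trans (cong (t x +ᶻ u x +ᶻ_) (∑ᶻ-+ xs t u)) (+ᶻ-interchange (t x) (u x) (∑ᶻ xs t) (∑ᶻ xs u))

  ∑ᶻ-*ˡ : ∀ c xs (t : A → ℤ) → c *ᶻ ∑ᶻ xs t ≡ ∑ᶻ xs (λ x → c *ᶻ t x)
  ∑ᶻ-*ˡ c []       t = ℤ.*-zeroʳ c
  ∑ᶻ-*ˡ c (x ∷ xs) t = trans (ℤ.*-distribˡ-+ c (t x) _) (cong (c *ᶻ t x +ᶻ_) (∑ᶻ-*ˡ c xs t))

  ∑ᶻ-*ʳ : ∀ c xs (t : A → ℤ) → ∑ᶻ xs t *ᶻ c ≡ ∑ᶻ xs (λ x → t x *ᶻ c)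
  ∑ᶻ-*ʳ c []       t = refl
  ∑ᶻ-*ʳ c (x ∷ xs) t = trans (ℤ.*-distribʳ-+ c (t x) _) (cong (t x *ᶻ c +ᶻ_) (∑ᶻ-*ʳ c xs t))

  ∑ᶻ-↭ : ∀ {xs ys} (t : A → ℤ) → xs ↭ ys → ∑ᶻ xs t ≡ ∑ᶻ ys t
  ∑ᶻ-↭ t Perm.refl          = refl
  ∑ᶻ-↭ t (Perm.prep x p)    = cong (t x +ᶻ_) (∑ᶻ-↭ t p)
  ∑ᶻ-↭ t (Perm.trans p q)   = trans (∑ᶻ-↭ t p) (∑ᶻ-↭ t q)
  ∑ᶻ-↭ {_ ∷ _ ∷ xs} t (Perm.swap x y p) =
    trans (left-comm (t x) (t y) (∑ᶻ xs t)) (cong (λ s → t y +ᶻ (t x +ᶻ s)) (∑ᶻ-↭ t p))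
    where
    left-comm : ∀ a b c → a +ᶻ (b +ᶻ c) ≡ b +ᶻ (a +ᶻ c)
    left-comm = solve-∀

  ∑ᶻ-map : ∀ {B : Set} (g : B → A) ys (t : A → ℤ) → ∑ᶻ (map g ys) t ≡ ∑ᶻ ys (t ∘ g)
  ∑ᶻ-map g []       t = refl
  ∑ᶻ-map g (y ∷ ys) t = cong (t (g y) +ᶻ_) (∑ᶻ-map g ys t)

  ∑ᶻ-concatMap : ∀ {B : Set} (g : B → List A) ys (t : A → ℤ) →
                 ∑ᶻ (concatMap g ys) t ≡ ∑ᶻ ys (λ y → ∑ᶻ (g y) t)
  ∑ᶻ-concatMap g []       t = refl
  ∑ᶻ-concatMap g (y ∷ ys) t = trans (∑ᶻ-++ (g y) t) (cong (∑ᶻ (g y) t +ᶻ_) (∑ᶻ-concatMap g ys t))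

  ∑ᶻ-cartesianProductWith : ∀ {B C : Set} (g : B → C → A) xs ys (t : A → ℤ) →
    ∑ᶻ (cartesianProductWith g xs ys) t ≡ ∑ᶻ xs (λ x → ∑ᶻ ys (λ y → t (g x y)))
  ∑ᶻ-cartesianProductWith g []       ys t = refl
  ∑ᶻ-cartesianProductWith g (x ∷ xs) ys t =
    trans (∑ᶻ-++ (map (g x) ys) t) (cong₂ _+ᶻ_ (∑ᶻ-map (g x) ys t) (∑ᶻ-cartesianProductWith g xs ys t))

∑ᶻ-swap : ∀ {A B : Set} xs (ys : List B) (t : A → B → ℤ) →
          ∑ᶻ xs (λ x → ∑ᶻ ys (t x)) ≡ ∑ᶻ ys (λ y → ∑ᶻ xs (λ x → t x y))
∑ᶻ-swap []       ys t = sym (∑ᶻ-0 ys)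
∑ᶻ-swap (x ∷ xs) ys t = trans (cong (∑ᶻ ys (t x) +ᶻ_) (∑ᶻ-swap xs ys t)) (sym (∑ᶻ-+ ys _ _))

⟦_⟧ : Bool → ℤ
⟦ true  ⟧ = 1ℤ
⟦ false ⟧ = 0ℤ

⟦∧⟧ : ∀ a b → ⟦ a ∧ b ⟧ ≡ ⟦ a ⟧ *ᶻ ⟦ b ⟧
⟦∧⟧ true  b = sym (ℤ.*-identityˡ ⟦ b ⟧)
⟦∧⟧ false b = refl

∑ᶻ-filter : ∀ {A : Set} {P : A → Set} (P? : Decidable P) xs (t : A → ℤ) →
            ∑ᶻ (filter P? xs) t ≡ ∑ᶻ xs (λ x → ⟦ does (P? x) ⟧ *ᶻ t x)
∑ᶻ-filter P? []       t = refl
∑ᶻ-filter P? (x ∷ xs) t with does (P? x)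
... | true  = cong₂ _+ᶻ_ (sym (ℤ.*-identityˡ (t x))) (∑ᶻ-filter P? xs t)
... | false = trans (∑ᶻ-filter P? xs t) (sym (ℤ.+-identityˡ _))

∏ : ∀ {m} → (Fin m → ℤ) → ℤ
∏ {zero}  t = 1ℤ
∏ {suc m} t = t zero *ᶻ ∏ (t ∘ suc)

∏-cong : ∀ {m} {t u : Fin m → ℤ} → (∀ j → t j ≡ u j) → ∏ t ≡ ∏ u
∏-cong {zero}  eq = refl
∏-cong {suc m} eq = cong₂ _*ᶻ_ (eq zero) (∏-cong (eq ∘ suc))

⟦all⟧ : ∀ {A : Set} {P : A → Set} (P? : Decidable P) {m} (g : Fin m → A) →
        ⟦ does (All.all? P? (tabulate g)) ⟧ ≡ ∏ (λ j → ⟦ does (P? (g j)) ⟧)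
⟦all⟧ P? {zero}  g = refl
⟦all⟧ P? {suc m} g = trans (⟦∧⟧ (does (P? (g zero))) _) (cong (⟦ does (P? (g zero)) ⟧ *ᶻ_) (⟦all⟧ P? (g ∘ suc)))

-- The common pattern `y`, later 312, stays in the range of summation, and the remaining patterns
-- become indicator factors. Sums for different pattern sets then run over one and the same list and
-- can be interchanged.
∑ᶻ-filter-all : ∀ {A B : Set} {R : A → B → Set} (R? : ∀ a → Decidable (R a)) xs y {m} (g : Fin m → B) t →
  ∑ᶻ (filter (λ x → All.all? (R? x) (y ∷ tabulate g)) xs) t ≡
  ∑ᶻ (filter (λ x → All.all? (R? x) (y ∷ [])) xs) (λ x → ∏ (λ j → ⟦ does (R? x (g j)) ⟧) *ᶻ t x)
∑ᶻ-filter-all R? xs y g t = begin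
  ∑ᶻ (filter (λ x → All.all? (R? x) (y ∷ tabulate g)) xs) t
    ≡⟨ ∑ᶻ-filter _ xs t ⟩
  ∑ᶻ xs (λ x → ⟦ does (R? x y) ∧ does (All.all? (R? x) (tabulate g)) ⟧ *ᶻ t x)
    ≡⟨ ∑ᶻ-cong xs (λ x → begin
         ⟦ does (R? x y) ∧ does (All.all? (R? x) (tabulate g)) ⟧ *ᶻ t x
           ≡⟨ cong (_*ᶻ t x) (⟦∧⟧ (does (R? x y)) _) ⟩
         ⟦ does (R? x y) ⟧ *ᶻ ⟦ does (All.all? (R? x) (tabulate g)) ⟧ *ᶻ t x
           ≡⟨ ℤ.*-assoc ⟦ does (R? x y) ⟧ _ _ ⟩
         ⟦ does (R? x y) ⟧ *ᶻ (⟦ does (All.all? (R? x) (tabulate g)) ⟧ *ᶻ t x)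
           ≡⟨ cong₂ (λ a b → ⟦ a ⟧ *ᶻ (b *ᶻ t x)) (sym (∧-identityʳ (does (R? x y)))) (⟦all⟧ (R? x) g) ⟩
         ⟦ does (R? x y) ∧ true ⟧ *ᶻ (∏ (λ j → ⟦ does (R? x (g j)) ⟧) *ᶻ t x) ∎) ⟩
  ∑ᶻ xs (λ x → ⟦ does (R? x y) ∧ true ⟧ *ᶻ (∏ (λ j → ⟦ does (R? x (g j)) ⟧) *ᶻ t x))
    ≡⟨ ∑ᶻ-filter (λ x → All.all? (R? x) (y ∷ [])) xs _ ⟨
  ∑ᶻ (filter (λ x → All.all? (R? x) (y ∷ [])) xs) (λ x → ∏ (λ j → ⟦ does (R? x (g j)) ⟧) *ᶻ t x) ∎
  where open ≡-Reasoning

-- Linear functionals on ℤ[q]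

-- Equality in ℤ[q] is equality of coefficients, and a coefficient of a product depends linearly on
-- each factor. Fixing one coefficient from the start therefore turns the identity into one between
-- integer sums, and each `F` is expanded by `φ-∑` in place.
record Linear (φ : ℤ[q] → ℤ) : Set where
  field
    φ-𝟘 : φ 𝟘 ≡ 0ℤ
    φ-⊞ : ∀ p r → φ (p ⊞ r) ≡ φ p +ᶻ φ r
    φ-· : ∀ c p → φ (c · p) ≡ c *ᶻ φ p

  φ-∑ : ∀ {A : Set} (xs : List A) t → φ (∑ xs t) ≡ ∑ᶻ xs (φ ∘ t)
  φ-∑ []       t = φ-𝟘
  φ-∑ (x ∷ xs) t = trans (φ-⊞ (t x) (∑ xs t)) (cong (φ (t x) +ᶻ_) (φ-∑ xs t))

open Linear

Linear-resp-≗ : ∀ {φ ψ} → (∀ p → φ p ≡ ψ p) → Linear φ → Linear ψ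
Linear-resp-≗ eq lin = record
  { φ-𝟘 = trans (sym (eq 𝟘)) (φ-𝟘 lin)
  ; φ-⊞ = λ p r → trans (sym (eq (p ⊞ r))) (trans (φ-⊞ lin p r) (cong₂ _+ᶻ_ (eq p) (eq r)))
  ; φ-· = λ c p → trans (sym (eq (c · p))) (trans (φ-· lin c p) (cong (c *ᶻ_) (eq p)))
  }

0-linear : Linear (λ _ → 0ℤ)
0-linear = record { φ-𝟘 = refl ; φ-⊞ = λ _ _ → refl ; φ-· = λ c _ → sym (ℤ.*-zeroʳ c) }

+-linear : ∀ {φ ψ} → Linear φ → Linear ψ → Linear (λ p → φ p +ᶻ ψ p)
+-linear {φ} {ψ} lφ lψ = record
  { φ-𝟘 = cong₂ _+ᶻ_ (φ-𝟘 lφ) (φ-𝟘 lψ)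
  ; φ-⊞ = λ p r → trans (cong₂ _+ᶻ_ (φ-⊞ lφ p r) (φ-⊞ lψ p r)) (+ᶻ-interchange (φ p) (φ r) (ψ p) (ψ r))
  ; φ-· = λ c p → trans (cong₂ _+ᶻ_ (φ-· lφ c p) (φ-· lψ c p)) (sym (ℤ.*-distribˡ-+ c (φ p) (ψ p)))
  }

*-linear : ∀ {φ} c → Linear φ → Linear (λ p → c *ᶻ φ p)
*-linear {φ} c lφ = record
  { φ-𝟘 = trans (cong (c *ᶻ_) (φ-𝟘 lφ)) (ℤ.*-zeroʳ c)
  ; φ-⊞ = λ p r → trans (cong (c *ᶻ_) (φ-⊞ lφ p r)) (ℤ.*-distribˡ-+ c (φ p) (φ r))
  ; φ-· = λ e p → trans (cong (c *ᶻ_) (φ-· lφ e p)) (left-comm c e (φ p))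
  }
  where
  left-comm : ∀ a b x → a *ᶻ (b *ᶻ x) ≡ b *ᶻ (a *ᶻ x)
  left-comm = solve-∀

coeff-⊞ : ∀ p r d → coeff (p ⊞ r) d ≡ coeff p d +ᶻ coeff r d
coeff-⊞ []      r       d       = sym (ℤ.+-identityˡ _)
coeff-⊞ (c ∷ p) []      d       = sym (ℤ.+-identityʳ _)
coeff-⊞ (c ∷ p) (e ∷ r) zero    = refl
coeff-⊞ (c ∷ p) (e ∷ r) (suc d) = coeff-⊞ p r d

coeff-· : ∀ c p d → coeff (c · p) d ≡ c *ᶻ coeff p d
coeff-· c []      d       = sym (ℤ.*-zeroʳ c)
coeff-· c (e ∷ p) zero    = refl
coeff-· c (e ∷ p) (suc d) = coeff-· c p d

coeff-linear : ∀ d → Linear (λ p → coeff p d)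
coeff-linear d = record { φ-𝟘 = refl ; φ-⊞ = λ p r → coeff-⊞ p r d ; φ-· = λ c p → coeff-· c p d }

coeff-∷⊠ : ∀ c p r d → coeff ((c ∷ p) ⊠ r) d ≡ c *ᶻ coeff r d +ᶻ coeff (0ℤ ∷ (p ⊠ r)) d
coeff-∷⊠ c p r d = trans (coeff-⊞ (c · r) _ d) (cong (_+ᶻ coeff (0ℤ ∷ (p ⊠ r)) d) (coeff-· c r d))

⊠-linearʳ : ∀ p d → Linear (λ r → coeff (p ⊠ r) d)
⊠-linearʳ []      d = 0-linear
⊠-linearʳ (c ∷ p) d = Linear-resp-≗ (λ r → sym (coeff-∷⊠ c p r d))
  (+-linear (*-linear c (coeff-linear d)) (shifted d))
  where
  shifted : ∀ d → Linear (λ r → coeff (0ℤ ∷ (p ⊠ r)) d)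
  shifted zero    = 0-linear
  shifted (suc d) = ⊠-linearʳ p d

⊠-linearˡ : ∀ r d → Linear (λ p → coeff (p ⊠ r) d)
⊠-linearˡ r d = record { φ-𝟘 = refl ; φ-⊞ = λ p p′ → additive p p′ d ; φ-· = λ c p → homogeneous c p d }
  where
  open ≡-Reasoning
  additive : ∀ p p′ d → coeff ((p ⊞ p′) ⊠ r) d ≡ coeff (p ⊠ r) d +ᶻ coeff (p′ ⊠ r) d
  additive []      p′       d = sym (ℤ.+-identityˡ _)
  additive (c ∷ p) []       d = sym (ℤ.+-identityʳ _)
  additive (c ∷ p) (e ∷ p′) d = begin
    coeff (((c +ᶻ e) ∷ (p ⊞ p′)) ⊠ r) d
      ≡⟨ coeff-∷⊠ (c +ᶻ e) (p ⊞ p′) r d ⟩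
    (c +ᶻ e) *ᶻ coeff r d +ᶻ coeff (0ℤ ∷ ((p ⊞ p′) ⊠ r)) d
      ≡⟨ cong ((c +ᶻ e) *ᶻ coeff r d +ᶻ_) (shifted d) ⟩
    (c +ᶻ e) *ᶻ coeff r d +ᶻ (coeff (0ℤ ∷ (p ⊠ r)) d +ᶻ coeff (0ℤ ∷ (p′ ⊠ r)) d)
      ≡⟨ rearrange c e (coeff r d) _ _ ⟩
    (c *ᶻ coeff r d +ᶻ coeff (0ℤ ∷ (p ⊠ r)) d) +ᶻ (e *ᶻ coeff r d +ᶻ coeff (0ℤ ∷ (p′ ⊠ r)) d)
      ≡⟨ cong₂ _+ᶻ_ (coeff-∷⊠ c p r d) (coeff-∷⊠ e p′ r d) ⟨
    coeff ((c ∷ p) ⊠ r) d +ᶻ coeff ((e ∷ p′) ⊠ r) d ∎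
    where
    rearrange : ∀ c e x y z → (c +ᶻ e) *ᶻ x +ᶻ (y +ᶻ z) ≡ (c *ᶻ x +ᶻ y) +ᶻ (e *ᶻ x +ᶻ z)
    rearrange = solve-∀
    shifted : ∀ d → coeff (0ℤ ∷ ((p ⊞ p′) ⊠ r)) d ≡ coeff (0ℤ ∷ (p ⊠ r)) d +ᶻ coeff (0ℤ ∷ (p′ ⊠ r)) d
    shifted zero    = refl
    shifted (suc d) = additive p p′ d
  homogeneous : ∀ c p d → coeff ((c · p) ⊠ r) d ≡ c *ᶻ coeff (p ⊠ r) d
  homogeneous c []      d = sym (ℤ.*-zeroʳ c)
  homogeneous c (e ∷ p) d = begin
    coeff ((c *ᶻ e ∷ c · p) ⊠ r) d
      ≡⟨ coeff-∷⊠ (c *ᶻ e) (c · p) r d ⟩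
    c *ᶻ e *ᶻ coeff r d +ᶻ coeff (0ℤ ∷ ((c · p) ⊠ r)) d
      ≡⟨ cong (c *ᶻ e *ᶻ coeff r d +ᶻ_) (shifted d) ⟩
    c *ᶻ e *ᶻ coeff r d +ᶻ c *ᶻ coeff (0ℤ ∷ (p ⊠ r)) d
      ≡⟨ factor c e (coeff r d) _ ⟩
    c *ᶻ (e *ᶻ coeff r d +ᶻ coeff (0ℤ ∷ (p ⊠ r)) d)
      ≡⟨ cong (c *ᶻ_) (coeff-∷⊠ e p r d) ⟨
    c *ᶻ coeff ((e ∷ p) ⊠ r) d ∎
    where
    factor : ∀ c e x y → c *ᶻ e *ᶻ x +ᶻ c *ᶻ y ≡ c *ᶻ (e *ᶻ x +ᶻ y)
    factor = solve-∀
    shifted : ∀ d → coeff (0ℤ ∷ ((c · p) ⊠ r)) d ≡ c *ᶻ coeff (0ℤ ∷ (p ⊠ r)) d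
    shifted zero    = sym (ℤ.*-zeroʳ c)
    shifted (suc d) = homogeneous c p d

coeff-0∷[] : ∀ d → coeff (0ℤ ∷ []) d ≡ 0ℤ
coeff-0∷[] zero    = refl
coeff-0∷[] (suc d) = refl

coeff-q⁰⊠ : ∀ p d → coeff ((q^ 0) ⊠ p) d ≡ coeff p d
coeff-q⁰⊠ p d = trans (coeff-∷⊠ 1ℤ [] p d)
  (trans (cong₂ _+ᶻ_ (ℤ.*-identityˡ (coeff p d)) (coeff-0∷[] d)) (ℤ.+-identityʳ _))

coeff-qˢ⊠ : ∀ e p d → coeff ((q^ suc e) ⊠ p) d ≡ coeff (0ℤ ∷ ((q^ e) ⊠ p)) d
coeff-qˢ⊠ e p d = trans (coeff-∷⊠ 0ℤ (q^ e) p d) (ℤ.+-identityˡ _)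

q^⊠-cong : ∀ e {p r} → p ≈ r → (q^ e) ⊠ p ≈ (q^ e) ⊠ r
q^⊠-cong zero    {p} {r} eq d = trans (coeff-q⁰⊠ p d) (trans (eq d) (sym (coeff-q⁰⊠ r d)))
q^⊠-cong (suc e) {p} {r} eq d = trans (coeff-qˢ⊠ e p d) (trans (shifted d) (sym (coeff-qˢ⊠ e r d)))
  where
  shifted : ∀ d → coeff (0ℤ ∷ ((q^ e) ⊠ p)) d ≡ coeff (0ℤ ∷ ((q^ e) ⊠ r)) d
  shifted zero    = refl
  shifted (suc d) = q^⊠-cong e eq d

-- `g` will be the identity or multiplication by a fixed polynomial from either side, so that one
-- factor under `q^ e` can be expanded while the other is held fixed.
q^⊠-linear : ∀ (g : ℤ[q] → ℤ[q]) → (∀ d → Linear (λ p → coeff (g p) d)) →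
             ∀ e d → Linear (λ p → coeff ((q^ e) ⊠ g p) d)
q^⊠-linear g lin zero    d = Linear-resp-≗ (λ p → sym (coeff-q⁰⊠ (g p) d)) (lin d)
q^⊠-linear g lin (suc e) d = Linear-resp-≗ (λ p → sym (coeff-qˢ⊠ e (g p) d)) (shifted d)
  where
  shifted : ∀ d → Linear (λ p → coeff (0ℤ ∷ ((q^ e) ⊠ g p)) d)
  shifted zero    = 0-linear
  shifted (suc d) = q^⊠-linear g lin e d

q^-+ : ∀ a b → (q^ a) ⊠ (q^ b) ≈ q^ (a + b)
q^-+ zero    b d = coeff-q⁰⊠ (q^ b) d
q^-+ (suc a) b d = trans (coeff-qˢ⊠ a (q^ b) d) (shifted d)
  where
  shifted : ∀ d → coeff (0ℤ ∷ ((q^ a) ⊠ (q^ b))) d ≡ coeff (q^ suc (a + b)) d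
  shifted zero    = refl
  shifted (suc d) = q^-+ a b d

-- The alternating sum

∑< : ℕ → (ℕ → ℤ) → ℤ
∑< zero    t = 0ℤ
∑< (suc n) t = t 0 +ᶻ ∑< n (t ∘ suc)

∑<-cong : ∀ n {t u} → (∀ i → t i ≡ u i) → ∑< n t ≡ ∑< n u
∑<-cong zero    eq = refl
∑<-cong (suc n) eq = cong₂ _+ᶻ_ (eq 0) (∑<-cong n (eq ∘ suc))

∑ᶻ-applyUpTo : ∀ {A : Set} (f : ℕ → A) n t → ∑ᶻ (applyUpTo f n) t ≡ ∑< n (t ∘ f)
∑ᶻ-applyUpTo f zero    t = refl
∑ᶻ-applyUpTo f (suc n) t = cong (t (f 0) +ᶻ_) (∑ᶻ-applyUpTo (f ∘ suc) n t)

-- For a single pattern these two sums are the terms S = ∅ and S = {1} of the bracket, with indices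
-- counted from 0. For r = 0 both are empty.
alternating : ℕ → (ℕ → ℤ) → (ℕ → ℤ) → ℤ
alternating r a b = ∑< r (λ i → a i *ᶻ b i) +ᶻ -1ℤ *ᶻ ∑< (r ∸ 1) (λ i → a i *ᶻ b (suc i))

meets : ℕ → (ℕ → Bool) → (ℕ → Bool) → Bool
meets zero    α β = false
meets (suc r) α β = (α 0 ∧ β 0) ∨ meets r (α ∘ suc) (β ∘ suc)

meets⁻ : ∀ r α β → meets r α β ≡ true → ∃ λ i → i < r × α i ≡ true × β i ≡ true
meets⁻ (suc r) α β eq with α 0 in eqα | β 0 in eqβ
... | true  | true  = 0 , s≤s z≤n , eqα , eqβ
... | true  | false = let (i , i< , p) = meets⁻ r (α ∘ suc) (β ∘ suc) eq in suc i , s≤s i< , p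
... | false | _     = let (i , i< , p) = meets⁻ r (α ∘ suc) (β ∘ suc) eq in suc i , s≤s i< , p

meets⁺ : ∀ r α β i → i < r → α i ≡ true → β i ≡ true → meets r α β ≡ true
meets⁺ (suc r) α β zero    _        p q rewrite p | q = refl
meets⁺ (suc r) α β (suc i) (s≤s i<) p q with α 0 ∧ β 0
... | true  = refl
... | false = meets⁺ r (α ∘ suc) (β ∘ suc) i i< p q

meets-false : ∀ r α β → (∀ i → suc i < r → β (suc i) ≡ true → β i ≡ true) → β 0 ≡ false → meets r α β ≡ false
meets-false zero    α β mono β0 = refl
meets-false (suc zero) α β mono β0 rewrite β0 with α 0
... | true  = refl
... | false = refl
meets-false (suc (suc r)) α β mono β0 =
  cong₂ _∨_ (trans (cong (α 0 ∧_) β0) (∧-zeroʳ (α 0)))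
    (meets-false (suc r) (α ∘ suc) (β ∘ suc) (λ i i< → mono (suc i) (s≤s i<)) β1)
  where
  β1 : β 1 ≡ false
  β1 with β 1 in eq
  ... | false = refl
  ... | true  = contradiction (trans (sym β0) (mono 0 (s≤s (s≤s z≤n)) eq)) λ ()

-- For α increasing and β decreasing the set of i with α i and β i is an
-- interval, and the alternating sum is its number of points minus its number
-- of pairs of neighbours.
alternating-meets : ∀ r α β →
  (∀ i → suc i < r → α i ≡ true → α (suc i) ≡ true) →
  (∀ i → suc i < r → β (suc i) ≡ true → β i ≡ true) →
  alternating r (⟦_⟧ ∘ α) (⟦_⟧ ∘ β) ≡ ⟦ meets r α β ⟧
alternating-meets zero          α β incα decβ = refl
alternating-meets (suc zero)    α β incα decβ = begin
  ⟦ α 0 ⟧ *ᶻ ⟦ β 0 ⟧ +ᶻ 0ℤ +ᶻ 0ℤ ≡⟨ trans (ℤ.+-identityʳ _) (ℤ.+-identityʳ _) ⟩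
  ⟦ α 0 ⟧ *ᶻ ⟦ β 0 ⟧               ≡⟨ ⟦∧⟧ (α 0) (β 0) ⟨
  ⟦ α 0 ∧ β 0 ⟧                     ≡⟨ cong ⟦_⟧ (∨-identityʳ (α 0 ∧ β 0)) ⟨
  ⟦ (α 0 ∧ β 0) ∨ false ⟧           ∎
  where open ≡-Reasoning
alternating-meets (suc (suc r)) α β incα decβ = begin
  alternating (suc (suc r)) (⟦_⟧ ∘ α) (⟦_⟧ ∘ β)
    ≡⟨ regroup ⟦ α 0 ⟧ ⟦ β 0 ⟧ ⟦ β 1 ⟧ _ _ ⟩
  ⟦ α 0 ⟧ *ᶻ (⟦ β 0 ⟧ -ᶻ ⟦ β 1 ⟧) +ᶻ alternating (suc r) (⟦_⟧ ∘ α ∘ suc) (⟦_⟧ ∘ β ∘ suc)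
    ≡⟨ cong (⟦ α 0 ⟧ *ᶻ (⟦ β 0 ⟧ -ᶻ ⟦ β 1 ⟧) +ᶻ_)
         (alternating-meets (suc r) (α ∘ suc) (β ∘ suc) (λ i i< → incα (suc i) (s≤s i<)) decβ′) ⟩
  ⟦ α 0 ⟧ *ᶻ (⟦ β 0 ⟧ -ᶻ ⟦ β 1 ⟧) +ᶻ ⟦ meets (suc r) (α ∘ suc) (β ∘ suc) ⟧
    ≡⟨ cases (α 0) (β 0) (β 1) (incα 0 1<) (decβ 0 1<)
         (λ α1 β1 → meets⁺ (suc r) (α ∘ suc) (β ∘ suc) 0 (s≤s z≤n) α1 β1)
         (meets-false (suc r) (α ∘ suc) (β ∘ suc) decβ′) ⟩
  ⟦ meets (suc (suc r)) α β ⟧ ∎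
  where
  open ≡-Reasoning
  1< : 1 < suc (suc r)
  1< = s≤s (s≤s z≤n)
  decβ′ : ∀ i → suc i < suc r → β (suc (suc i)) ≡ true → β (suc i) ≡ true
  decβ′ i i< = decβ (suc i) (s≤s i<)
  regroup : ∀ a b b′ s s′ → (a *ᶻ b +ᶻ s) +ᶻ -1ℤ *ᶻ (a *ᶻ b′ +ᶻ s′) ≡
                            a *ᶻ (b -ᶻ b′) +ᶻ (s +ᶻ -1ℤ *ᶻ s′)
  regroup = solve-∀
  -- If α 0 and β 1 hold, monotonicity puts both 0 and 1 into the interval: the new point is
  -- cancelled by the new pair, and `m` is already true. If α 0 and β 0 hold but β 1 fails, 0 is the
  -- only point and `m` is false.
  cases : ∀ a b b′ {a′ m} → (a ≡ true → a′ ≡ true) → (b′ ≡ true → b ≡ true) →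
          (a′ ≡ true → b′ ≡ true → m ≡ true) → (b′ ≡ false → m ≡ false) →
          ⟦ a ⟧ *ᶻ (⟦ b ⟧ -ᶻ ⟦ b′ ⟧) +ᶻ ⟦ m ⟧ ≡ ⟦ (a ∧ b) ∨ m ⟧
  cases false b     b′    _  _  _  _   = ℤ.+-identityˡ _
  cases true  true  true  p  _  m⁺ _   rewrite m⁺ (p refl) refl = refl
  cases true  true  false _  _  _  m⁻  rewrite m⁻ refl = refl
  cases true  false true  _  q  _  _   = contradiction (q refl) λ ()
  cases true  false false _  _  _  _   = ℤ.+-identityˡ _

does-true⁻ : ∀ {P : Set} (P? : Dec P) → does P? ≡ true → P
does-true⁻ (yes p) _ = p

≡does : ∀ {P : Set} b (P? : Dec P) → (b ≡ true → P) → (P → b ≡ true) → b ≡ does P?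
≡does b     (yes p) _  from = from p
≡does false (no _)  _  _    = refl
≡does true  (no ¬p) to _    = contradiction (to refl) ¬p

alternating-does : ∀ r {A B : ℕ → Set} {C : Set}
  (A? : ∀ i → Dec (A i)) (B? : ∀ i → Dec (B i)) (C? : Dec C) →
  (∀ i → suc i < r → A i → A (suc i)) →
  (∀ i → suc i < r → B (suc i) → B i) →
  (C → ∃ λ i → i < r × A i × B i) → ((∃ λ i → i < r × A i × B i) → C) →
  alternating r (λ i → ⟦ does (A? i) ⟧) (λ i → ⟦ does (B? i) ⟧) ≡ ⟦ does C? ⟧
alternating-does r A? B? C? incA decB to from = trans
  (alternating-meets r (does ∘ A?) (does ∘ B?)
    (λ i i< → dec-true (A? (suc i)) ∘ incA i i< ∘ does-true⁻ (A? i))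
    (λ i i< → dec-true (B? i) ∘ decB i i< ∘ does-true⁻ (B? (suc i))))
  (cong ⟦_⟧ (≡does _ C?
    (λ m → let (i , i< , a , b) = meets⁻ r (does ∘ A?) (does ∘ B?) m in
      from (i , i< , does-true⁻ (A? i) a , does-true⁻ (B? i) b))
    (λ c → let (i , i< , a , b) = to c in
      meets⁺ r (does ∘ A?) (does ∘ B?) i i< (dec-true (A? i) a) (dec-true (B? i) b))))

-- Expanding the product of alternating sums

-- One coordinate of the bracket, with j ∉ S in the first sum and j ∈ S in the second. The forms
-- `r ∸ 0` and `i + 0` are kept because `indexBounds` and `_+ᵥ_` produce them at a coordinate with δ
-- = 0.
factor : ℕ → (ℕ → ℤ) → (ℕ → ℤ) → ℤ
factor r a b = ∑ᶻ [1… r ∸ 0 ] (λ i → a i *ᶻ b (i + 0)) +ᶻ -1ℤ *ᶻ ∑ᶻ [1… r ∸ 1 ] (λ i → a i *ᶻ b (i + 1))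

factor≡alternating : ∀ r a b → factor r a b ≡ alternating r (a ∘ suc) (b ∘ suc)
factor≡alternating r a b = cong₂ (λ x y → x +ᶻ -1ℤ *ᶻ y)
  (trans (∑ᶻ-applyUpTo suc r _) (∑<-cong r λ i → cong (λ j → a (suc i) *ᶻ b (suc j)) (+-identityʳ i)))
  (trans (∑ᶻ-applyUpTo suc (r ∸ 1) _) (∑<-cong (r ∸ 1) λ i → cong (λ j → a (suc i) *ᶻ b (suc j)) (+-comm i 1)))

indexBounds : ∀ {m} → (Fin m → ℕ) → Subset m → Vec ℕ m
indexBounds r S = Vec.zipWith _∸_ (Vec.tabulate r) (δ S)

term : ∀ {m} → (Fin m → ℕ → ℤ) → (Fin m → ℕ → ℤ) → Subset m → Vec ℕ m → ℤ
term a b S I = ∏ (λ j → a j (Vec.lookup I j)) *ᶻ ∏ (λ j → b j (Vec.lookup (I +ᵥ δ S) j))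

-- Distributivity, one coordinate at a time: whether the first pattern belongs to S and which index
-- it receives are chosen independently of the rest of S and I, and the sign is multiplicative.
∏-factor : ∀ {m} (r : Fin m → ℕ) (a b : Fin m → ℕ → ℤ) →
  ∑ᶻ (subsets m) (λ S → (-1ℤ ^ℤ card S) *ᶻ ∑ᶻ (tuples (indexBounds r S)) (term a b S)) ≡
  ∏ (λ j → factor (r j) (a j) (b j))
∏-factor {zero}  r a b = refl
∏-factor {suc m} r a b = begin
  ∑ᶻ (subsets (suc m)) (λ S → sign S *ᶻ ∑ᶻ (tuples (indexBounds r S)) (term a b S))
    ≡⟨ ∑ᶻ-cartesianProductWith _∷_ (outside ∷ inside ∷ []) (subsets m) _ ⟩
  ∑ᶻ (subsets m) (λ S → sign S *ᶻ ∑ᶻ (tuples (indexBounds r (outside ∷ S))) (term a b (outside ∷ S)))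
    +ᶻ (∑ᶻ (subsets m) (λ S →
          -1ℤ *ᶻ sign S *ᶻ ∑ᶻ (tuples (indexBounds r (inside ∷ S))) (term a b (inside ∷ S))) +ᶻ 0ℤ)
    ≡⟨ cong₂ (λ x y → x +ᶻ (y +ᶻ 0ℤ))
         (trans (∑ᶻ-cong (subsets m) λ S →
                  trans (cong (sign S *ᶻ_) (separate 0 (r zero ∸ 0) S)) (front (sign S) (X 0) (G S)))
                (sym (∑ᶻ-*ˡ (X 0) (subsets m) _)))
         (trans (∑ᶻ-cong (subsets m) λ S →
                  trans (cong (-1ℤ *ᶻ sign S *ᶻ_) (separate 1 (r zero ∸ 1) S)) (front′ (sign S) (X 1) (G S)))
                (sym (∑ᶻ-*ˡ (-1ℤ *ᶻ X 1) (subsets m) _))) ⟩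
  X 0 *ᶻ Y +ᶻ (-1ℤ *ᶻ X 1 *ᶻ Y +ᶻ 0ℤ)
    ≡⟨ collect (X 0) (-1ℤ *ᶻ X 1) Y ⟩
  factor (r zero) (a zero) (b zero) *ᶻ Y
    ≡⟨ cong (factor (r zero) (a zero) (b zero) *ᶻ_) (∏-factor (r ∘ suc) (a ∘ suc) (b ∘ suc)) ⟩
  ∏ (λ j → factor (r j) (a j) (b j)) ∎
  where
  open ≡-Reasoning
  sign : ∀ {m} → Subset m → ℤ
  sign S = -1ℤ ^ℤ card S
  G : Subset m → ℤ
  G S = ∑ᶻ (tuples (indexBounds (r ∘ suc) S)) (term (a ∘ suc) (b ∘ suc) S)
  Y : ℤ
  Y = ∑ᶻ (subsets m) (λ S → sign S *ᶻ G S)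
  X : ℕ → ℤ
  X e = ∑ᶻ [1… r zero ∸ e ] (λ i → a zero i *ᶻ b zero (i + e))
  front : ∀ s x g → s *ᶻ (x *ᶻ g) ≡ x *ᶻ (s *ᶻ g)
  front = solve-∀
  front′ : ∀ s x g → -1ℤ *ᶻ s *ᶻ (x *ᶻ g) ≡ -1ℤ *ᶻ x *ᶻ (s *ᶻ g)
  front′ = solve-∀
  collect : ∀ x y z → x *ᶻ z +ᶻ (y *ᶻ z +ᶻ 0ℤ) ≡ (x +ᶻ y) *ᶻ z
  collect = solve-∀
  interchange : ∀ x p y q → (x *ᶻ p) *ᶻ (y *ᶻ q) ≡ (x *ᶻ y) *ᶻ (p *ᶻ q)
  interchange = solve-∀
  -- Here `e` is the first coordinate of δ and `n` the bound on the first index. The sum over that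
  -- index splits off as a factor.
  separate : ∀ e n S →
    ∑ᶻ (tuples (n ∷ indexBounds (r ∘ suc) S)) (λ I →
        ∏ (λ j → a j (Vec.lookup I j)) *ᶻ ∏ (λ j → b j (Vec.lookup (I +ᵥ (e ∷ δ S)) j))) ≡
    ∑ᶻ [1… n ] (λ i → a zero i *ᶻ b zero (i + e)) *ᶻ G S
  separate e n S = begin
    _ ≡⟨ ∑ᶻ-cartesianProductWith _∷_ [1… n ] (tuples (indexBounds (r ∘ suc) S)) _ ⟩
    _ ≡⟨ ∑ᶻ-cong [1… n ] (λ i → trans
           (∑ᶻ-cong (tuples (indexBounds (r ∘ suc) S)) λ I →
             interchange (a zero i) (∏ (λ j → a (suc j) (Vec.lookup I j))) (b zero (i + e)) _)
           (sym (∑ᶻ-*ˡ (a zero i *ᶻ b zero (i + e)) (tuples (indexBounds (r ∘ suc) S)) _))) ⟩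
    _ ≡⟨ ∑ᶻ-*ʳ (G S) [1… n ] _ ⟨
    _ ∎

module _ {X Y : Set} (xs : List X) (ys : List Y) (M : X → Y → ℤ) where

  ∑ᶻ-exchange : ∀ {Z : Set} (zs : List Z) (N : Z → X → Y → ℤ) →
    ∑ᶻ zs (λ z → ∑ᶻ xs λ x → ∑ᶻ ys λ y → N z x y *ᶻ M x y) ≡
    ∑ᶻ xs (λ x → ∑ᶻ ys λ y → ∑ᶻ zs (λ z → N z x y) *ᶻ M x y)
  ∑ᶻ-exchange zs N = trans (∑ᶻ-swap zs xs _) (∑ᶻ-cong xs λ x → trans (∑ᶻ-swap zs ys _)
    (∑ᶻ-cong ys λ y → sym (∑ᶻ-*ʳ (M x y) zs (λ z → N z x y))))

  -- For fixed S and I the weight is a factor in σ₁ times a factor in σ₂, as a product of two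
  -- generating functions requires. With the sums over S and I moved inside, each pair (σ₁, σ₂)
  -- carries exactly the signed sum evaluated by `∏-factor`.
  ∑ᶻ-exchange₂ : ∀ {S I : Set} (Ss : List S) (Is : S → List I) (s : S → ℤ)
    (P : S → I → X → ℤ) (Q : S → I → Y → ℤ) →
    ∑ᶻ Ss (λ S → s S *ᶻ ∑ᶻ (Is S) λ I → ∑ᶻ xs λ x → P S I x *ᶻ ∑ᶻ ys λ y → Q S I y *ᶻ M x y) ≡
    ∑ᶻ xs (λ x → ∑ᶻ ys λ y → ∑ᶻ Ss (λ S → s S *ᶻ ∑ᶻ (Is S) λ I → P S I x *ᶻ Q S I y) *ᶻ M x y)
  ∑ᶻ-exchange₂ Ss Is s P Q = trans
    (∑ᶻ-cong Ss λ S → begin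
      s S *ᶻ ∑ᶻ (Is S) (λ I → ∑ᶻ xs λ x → P S I x *ᶻ ∑ᶻ ys λ y → Q S I y *ᶻ M x y)
        ≡⟨ cong (s S *ᶻ_) (∑ᶻ-cong (Is S) λ I → ∑ᶻ-cong xs λ x →
             trans (∑ᶻ-*ˡ (P S I x) ys _) (∑ᶻ-cong ys λ y → sym (ℤ.*-assoc (P S I x) _ _))) ⟩
      s S *ᶻ ∑ᶻ (Is S) (λ I → ∑ᶻ xs λ x → ∑ᶻ ys λ y → P S I x *ᶻ Q S I y *ᶻ M x y)
        ≡⟨ cong (s S *ᶻ_) (∑ᶻ-exchange (Is S) λ I x y → P S I x *ᶻ Q S I y) ⟩
      s S *ᶻ ∑ᶻ xs (λ x → ∑ᶻ ys λ y → ∑ᶻ (Is S) (λ I → P S I x *ᶻ Q S I y) *ᶻ M x y)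
        ≡⟨ trans (∑ᶻ-*ˡ (s S) xs _) (∑ᶻ-cong xs λ x →
             trans (∑ᶻ-*ˡ (s S) ys _) (∑ᶻ-cong ys λ y → sym (ℤ.*-assoc (s S) _ _))) ⟩
      ∑ᶻ xs (λ x → ∑ᶻ ys λ y → s S *ᶻ ∑ᶻ (Is S) (λ I → P S I x *ᶻ Q S I y) *ᶻ M x y) ∎)
    (∑ᶻ-exchange Ss λ S x y → s S *ᶻ ∑ᶻ (Is S) λ I → P S I x *ᶻ Q S I y)
    where open ≡-Reasoning

-- The generating function

avoids? : ∀ σ π → Dec (σ avoids π)
avoids? σ π = ¬? (contains? σ π)

avoid : 𝔖 → 𝔖 → ℤ
avoid σ π = ⟦ does (avoids? σ π) ⟧

φ-F : ∀ {φ} → Linear φ → ∀ st k {m} (g : Fin m → 𝔖) →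
      φ (F st k (p312 ∷ tabulate g)) ≡
      ∑ᶻ 𝔖₃₁₂[ k ] (λ σ → ∏ (λ j → avoid σ (g j)) *ᶻ φ (q^ st σ))
φ-F {φ} lin st k g = trans (φ-∑ lin (filter (avoidsAll? (p312 ∷ tabulate g)) 𝔖[ k ]) (λ σ → q^ st σ))
  (∑ᶻ-filter-all avoids? 𝔖[ k ] p312 g (λ σ → φ (q^ st σ)))

-- `φ-F` is applied twice, first to the left `F` and then, for each σ₁, to the right one. The
-- exponent is bracketed as in the hypothesis on `st`.
coeff-F⊠F : ∀ st e d k l {m} (g h : Fin m → 𝔖) →
  coeff ((q^ e) ⊠ (F st k (p312 ∷ tabulate g) ⊠ F st l (p312 ∷ tabulate h))) d ≡
  ∑ᶻ 𝔖₃₁₂[ k ] (λ σ₁ → ∏ (λ j → avoid σ₁ (g j)) *ᶻ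
    ∑ᶻ 𝔖₃₁₂[ l ] (λ σ₂ → ∏ (λ j → avoid σ₂ (h j)) *ᶻ coeff (q^ (e + st σ₁ + st σ₂)) d))
coeff-F⊠F st e d k l g h = trans
  (φ-F (q^⊠-linear (_⊠ F st l (p312 ∷ tabulate h)) (⊠-linearˡ (F st l (p312 ∷ tabulate h))) e d) st k g)
  (∑ᶻ-cong 𝔖₃₁₂[ k ] λ σ₁ → cong (∏ (λ j → avoid σ₁ (g j)) *ᶻ_) (trans
    (φ-F (q^⊠-linear ((q^ st σ₁) ⊠_) (⊠-linearʳ (q^ st σ₁)) e d) st l h)
    (∑ᶻ-cong 𝔖₃₁₂[ l ] λ σ₂ → cong (∏ (λ j → avoid σ₂ (h j)) *ᶻ_) (begin
      coeff ((q^ e) ⊠ ((q^ st σ₁) ⊠ (q^ st σ₂))) d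
        ≡⟨ q^⊠-cong e (q^-+ (st σ₁) (st σ₂)) d ⟩
      coeff ((q^ e) ⊠ (q^ (st σ₁ + st σ₂))) d
        ≡⟨ q^-+ e (st σ₁ + st σ₂) d ⟩
      coeff (q^ (e + (st σ₁ + st σ₂))) d
        ≡⟨ cong (λ x → coeff (q^ x) d) (+-assoc e (st σ₁) (st σ₂)) ⟨
      coeff (q^ (e + st σ₁ + st σ₂)) d ∎))))
  where open ≡-Reasoning

-- The alternating sum is 1 exactly when some index is good on both sides, which is
-- `SplitAvoidance`. For π = ε both sides vanish: there is no index, and ε is contained in
-- everything.
avoid-factor : ∀ σ₁ σ₂ π πs → π ≡ ι[ πs *] →
  factor (length πs) (λ i → avoid σ₁ (lower πs i)) (λ i → avoid σ₂ (upper πs i)) ≡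
  avoid 213[ σ₁ ,1, σ₂ ] π
avoid-factor σ₁ σ₂ π πs π≡ = trans
  (factor≡alternating (length πs) (λ i → avoid σ₁ (lower πs i)) (λ i → avoid σ₂ (upper πs i)))
  (alternating-does (length πs)
    (λ i → avoids? σ₁ (lower πs (suc i))) (λ i → avoids? σ₂ (upper πs (suc i)))
    (avoids? 213[ σ₁ ,1, σ₂ ] π)
    (λ i i< av c → av (lower-mono σ₁ πs (n≤1+n i) i< c))
    (λ i i< av c → av (upper-mono σ₂ πs (n≤1+n i) c))
    (avoids-213⁻ σ₁ σ₂ π πs word-π) (avoids-213⁺ σ₁ σ₂ π πs word-π))
  where
  word-π : word π ≡ blockWord 0 πs
  word-π = trans (cong word π≡) (word-ι* πs)

-- `𝔖[ 0 ]` reduces to `ε ∷ []`, validity proofs being irrelevant, so only the decision of the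
-- filter on ε counts, here and in `F₀-one`.
F₀-zero : ∀ st Π → ¬ AvoidsAll Π ε → F st 0 Π ≈ 𝟘
F₀-zero st Π ¬av d = cong (λ l → coeff (∑ l (λ σ → q^ st σ)) d) (filter-reject (avoidsAll? Π) ¬av)

F₀-one : ∀ st Π → st ε ≡ 0 → AvoidsAll Π ε → F st 0 Π ≈ 𝟙
F₀-one st Π st-ε av d = trans
  (cong (λ l → coeff (∑ l (λ σ → q^ st σ)) d) (filter-accept (avoidsAll? Π) av))
  (trans (coeff-⊞ (q^ st ε) 𝟘 d) (trans (ℤ.+-identityʳ _) (cong (λ e → coeff (q^ e) d) st-ε)))

contains-ε : ∀ σ → σ contains ε
contains-ε σ = ≼⇒contains {σ} {ε} []≼

ε-contains : ∀ π → ε contains π → π ≡ ε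
ε-contains (perm [] _)      c = refl
ε-contains (perm (_ ∷ _) _) ([] , [] , () , _)

module _
    (st : 𝔖 → ℕ) (f : ℕ → ℕ → ℕ)
    (st-213 : ∀ k n → k ≤ n → ∀ σ₁ σ₂ →
      σ₁ ∈𝔖 k ⟨ p312 ∷ [] ⟩ → σ₂ ∈𝔖 (n ∸ k) ⟨ p312 ∷ [] ⟩ →
      st 213[ σ₁ ,1, σ₂ ] ≡ f k (n ∸ k) + st σ₁ + st σ₂)
    {m : ℕ} (π : Fin m → 𝔖) (d : ∀ j → BlockDecomposition (π j))
    where

  coeff-F-suc : ∀ n e → coeff (F st (suc n) (p312 ∷ tabulate π)) e ≡
    ∑ᶻ (upTo (suc n)) (λ k → ∑ᶻ 𝔖₃₁₂[ k ] λ σ₁ → ∑ᶻ 𝔖₃₁₂[ n ∸ k ] λ σ₂ →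
      ∏ (λ j → avoid 213[ σ₁ ,1, σ₂ ] (π j)) *ᶻ coeff (q^ st 213[ σ₁ ,1, σ₂ ]) e)
  coeff-F-suc n e = begin
    coeff (F st (suc n) (p312 ∷ tabulate π)) e ≡⟨ φ-F (coeff-linear e) st (suc n) π ⟩
    ∑ᶻ 𝔖₃₁₂[ suc n ] W                         ≡⟨ ∑ᶻ-↭ W (𝔖₃₁₂-decomposition n) ⟩
    ∑ᶻ (map join (allPairs n)) W               ≡⟨ ∑ᶻ-map join (allPairs n) W ⟩
    ∑ᶻ (allPairs n) (W ∘ join)                 ≡⟨ ∑ᶻ-concatMap (splitPairs n) (upTo (suc n)) (W ∘ join) ⟩
    ∑ᶻ (upTo (suc n)) (λ k → ∑ᶻ (splitPairs n k) (W ∘ join))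
      ≡⟨ ∑ᶻ-cong (upTo (suc n)) (λ k → ∑ᶻ-cartesianProductWith _,_ 𝔖₃₁₂[ k ] 𝔖₃₁₂[ n ∸ k ] (W ∘ join)) ⟩
    ∑ᶻ (upTo (suc n)) (λ k → ∑ᶻ 𝔖₃₁₂[ k ] λ σ₁ → ∑ᶻ 𝔖₃₁₂[ n ∸ k ] λ σ₂ → W 213[ σ₁ ,1, σ₂ ]) ∎
    where
    open ≡-Reasoning
    W : 𝔖 → ℤ
    W σ = ∏ (λ j → avoid σ (π j)) *ᶻ coeff (q^ st σ) e

  summand : ℕ → ℕ → ℤ[q]
  summand n k = (q^ f k (n ∸ k)) ⊠
    (∑[ S ∈ subsets m ] (-1ℤ ^ℤ card S) · (∑[ I ∈ indices d S ]
      F st k (lowerΠ d I) ⊠ F st (n ∸ k) (upperΠ d (I +ᵥ δ S))))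

  coeff-summand : ∀ n k e → k ≤ n → coeff (summand n k) e ≡
    ∑ᶻ 𝔖₃₁₂[ k ] (λ σ₁ → ∑ᶻ 𝔖₃₁₂[ n ∸ k ] λ σ₂ →
      ∏ (λ j → avoid 213[ σ₁ ,1, σ₂ ] (π j)) *ᶻ coeff (q^ st 213[ σ₁ ,1, σ₂ ]) e)
  coeff-summand n k e k≤n = begin
    coeff (summand n k) e
      ≡⟨ φ-∑ lin (subsets m) _ ⟩
    ∑ᶻ (subsets m) (λ S → φ ((-1ℤ ^ℤ card S) · (∑[ I ∈ indices d S ] FF S I)))
      ≡⟨ ∑ᶻ-cong (subsets m) (λ S → trans (φ-· lin (-1ℤ ^ℤ card S) (∑[ I ∈ indices d S ] FF S I))
           (cong ((-1ℤ ^ℤ card S) *ᶻ_) (trans (φ-∑ lin (indices d S) (FF S))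
             (∑ᶻ-cong (indices d S) λ I → coeff-F⊠F st f₀ e k (n ∸ k) (lo I) (up (I +ᵥ δ S)))))) ⟩
    ∑ᶻ (subsets m) (λ S → (-1ℤ ^ℤ card S) *ᶻ ∑ᶻ (indices d S) λ I →
      ∑ᶻ 𝔖₃₁₂[ k ] λ σ₁ → P S I σ₁ *ᶻ ∑ᶻ 𝔖₃₁₂[ n ∸ k ] λ σ₂ → Q S I σ₂ *ᶻ M σ₁ σ₂)
      ≡⟨ ∑ᶻ-exchange₂ 𝔖₃₁₂[ k ] 𝔖₃₁₂[ n ∸ k ] M (subsets m) (indices d) (λ S → -1ℤ ^ℤ card S) P Q ⟩
    ∑ᶻ 𝔖₃₁₂[ k ] (λ σ₁ → ∑ᶻ 𝔖₃₁₂[ n ∸ k ] λ σ₂ →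
      ∑ᶻ (subsets m) (λ S → (-1ℤ ^ℤ card S) *ᶻ ∑ᶻ (indices d S) λ I → P S I σ₁ *ᶻ Q S I σ₂) *ᶻ M σ₁ σ₂)
      -- The summands are compared only at members of the two lists, because the hypothesis on `st`
      -- speaks of 312-avoiders of lengths k and n - k. For each pair the signed sum collapses to
      -- the indicator that 213[σ₁,1,σ₂] avoids every `π j`.
      ≡⟨ ∑ᶻ-cong-∈ 𝔖₃₁₂[ k ] (λ {σ₁} σ₁∈ → ∑ᶻ-cong-∈ 𝔖₃₁₂[ n ∸ k ] λ {σ₂} σ₂∈ → cong₂ _*ᶻ_
           (trans (∏-factor (λ j → r (d j)) (λ j i → avoid σ₁ (lower (blocks (d j)) i))
                      (λ j i → avoid σ₂ (upper (blocks (d j)) i)))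
             (∏-cong λ j → avoid-factor σ₁ σ₂ (π j) (blocks (d j)) (BlockDecomposition.decomposes (d j))))
           (cong (λ x → coeff (q^ x) e)
             (sym (st-213 k n k≤n σ₁ σ₂ (∈-𝔖₃₁₂⁻ k σ₁∈) (∈-𝔖₃₁₂⁻ (n ∸ k) σ₂∈))))) ⟩
    ∑ᶻ 𝔖₃₁₂[ k ] (λ σ₁ → ∑ᶻ 𝔖₃₁₂[ n ∸ k ] λ σ₂ →
      ∏ (λ j → avoid 213[ σ₁ ,1, σ₂ ] (π j)) *ᶻ coeff (q^ st 213[ σ₁ ,1, σ₂ ]) e) ∎
    where
    open ≡-Reasoning
    f₀ = f k (n ∸ k)
    φ : ℤ[q] → ℤ
    φ p = coeff ((q^ f₀) ⊠ p) e
    lin : Linear φ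
    lin = q^⊠-linear id coeff-linear f₀ e
    lo up : Vec ℕ m → Fin m → 𝔖
    lo I j = lower (blocks (d j)) (Vec.lookup I j)
    up I j = upper (blocks (d j)) (Vec.lookup I j)
    FF : _ → Vec ℕ m → ℤ[q]
    FF S I = F st k (lowerΠ d I) ⊠ F st (n ∸ k) (upperΠ d (I +ᵥ δ S))
    P Q : _ → Vec ℕ m → 𝔖 → ℤ
    P S I σ₁ = ∏ (λ j → avoid σ₁ (lo I j))
    Q S I σ₂ = ∏ (λ j → avoid σ₂ (up (I +ᵥ δ S) j))
    M : 𝔖 → 𝔖 → ℤ
    M σ₁ σ₂ = coeff (q^ (f₀ + st σ₁ + st σ₂)) e

  F-suc : ∀ n → F st (suc n) (p312 ∷ tabulate π) ≈ ∑ (upTo (suc n)) (summand n)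
  F-suc n e = trans (coeff-F-suc n e) (sym (trans (φ-∑ (coeff-linear e) (upTo (suc n)) (summand n))
    (∑ᶻ-cong-∈ (upTo (suc n)) λ {k} k∈ → coeff-summand n k e (s≤s⁻¹ (∈-upTo⁻ k∈)))))

theorem3p2 : (st : 𝔖 → ℕ) → st ε ≡ 0 →
    (f : ℕ → ℕ → ℕ) →
    (∀ k n → k ≤ n → ∀ σ₁ σ₂ →
    σ₁ ∈𝔖 k ⟨ p312 ∷ [] ⟩ → σ₂ ∈𝔖 (n ∸ k) ⟨ p312 ∷ [] ⟩ →
    st 213[ σ₁ ,1, σ₂ ] ≡ f k (n ∸ k) + st σ₁ + st σ₂) →
    (m : ℕ) → 1 ≤ m →
    (π : Fin m → 𝔖) → (∀ j → π j avoids p312) →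
    (d : ∀ j → BlockDecomposition (π j)) →
    let Π = p312 ∷ tabulate π in
    ((∃[ j ] π j ≡ ε) → F st 0 Π ≈ 𝟘) ×
    (¬ (∃[ j ] π j ≡ ε) → F st 0 Π ≈ 𝟙) ×
    (∀ n → 1 ≤ n →
    F st (suc n) Π ≈
    (∑[ k ∈ upTo (suc n) ]
    (q^ f k (n ∸ k)) ⊠
    (∑[ S ∈ subsets m ]
    (-1ℤ ^ℤ card S) ·
    (∑[ I ∈ indices d S ]
    F st k (lowerΠ d I) ⊠ F st (n ∸ k) (upperΠ d (I +ᵥ δ S))))))
theorem3p2 st st-ε f st-213 m _ π _ d =
    (λ (j , πj≡ε) → F₀-zero st (p312 ∷ tabulate π) λ av →
      All.tabulate⁻ {f = π} (All.tail av) j (subst (ε contains_) (sym πj≡ε) (contains-ε ε)))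
  , (λ ¬ε → F₀-one st (p312 ∷ tabulate π) st-ε
      ((λ c → contradiction (cong word (ε-contains p312 c)) λ ())
       ∷ All.tabulate⁺ λ j c → ¬ε (j , ε-contains (π j) c)))
  , λ n _ → F-suc st f st-213 π d n
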